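{- Let $n,m$ be integers with $2\leq m\leq \lfloor n/2\rfloor$, let $G$ be a connected unicyclic graph on $n$ vertices with matching number $m$, and let $D$ be an orientation of $G$. Then $$M_1(D)\leq \frac{1}{2}\left[n^{2}+(-2m+3)n+m^{2}+m-2\right],$$ with equality if and only if $D\in U^{*}_{n,m}$.
   Context: All graphs are finite and simple. For a digraph $D=(V,A)$, $d^{+}_u$ and $d^{ - }_u$ denote the out-degree and in-degree of $u$, and the first Zagreb index of $D$ is $M_1(D)=\frac{1}{2}\sum_{uv\in A}(d^{+}_u+d^{ - }_v)$, where $uv$ denotes an arc from $u$ to $v$. An orientation of a graph $G$ is a digraph obtained by replacing each edge $uv$ by exactly one of the arcs $uv$, $vu$. A vertex is a source if its in-degree is $0$ and a sink if its out-degree is $0$; a sink-source orientation is one in which every vertex is a source or a sink. The matching number is the maximum size of a matching. $U_{n,m}$ denotes the graph obtained from a triangle by attaching $n-2m+1$ pendent vertices and $m-2$ paths of length $2$ (each path $w x y$ with $x,y$ new vertices) to one common vertex $w$ of the triangle; let $a,b$ be the other two triangle vertices. Define four orientations of $U_{n,m}$: those in which (i) every arc incident with $w$ leaves $w$, and every middle vertex $x$ of an attached path $wxy$ has both its arcs entering $x$; or (ii) the reverse of an orientation of type (i) (every arc at $w$ enters $w$ and each such $x$ has both arcs leaving it); in each case the edge $ab$ may be oriented either way. Call these four orientations $U^{(1)}_{n,m},\dots,U^{(4)}_{n,m}$. For $(n,m)\neq(4,2),(6,3)$, $U^{*}_{n,m}=\{U^{(1)}_{n,m},\dots,U^{(4)}_{n,m}\}$.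 $U^{*}_{4,2}$ consists of $U^{(1)}_{4,2},\dots,U^{(4)}_{4,2}$ together with the two sink-source orientations of the cycle $C_4$. $U^{*}_{6,3}$ consists of $U^{(1)}_{6,3},\dots,U^{(4)}_{6,3}$ together with the two sink-source orientations of the graph obtained from $C_4$ by attaching one pendent vertex to each of two adjacent vertices of the cycle. -}

module Defs where

open import Data.Bool using (Bool; true; false; _∧_; _∨_; not; if_then_else_)
open import Data.Nat using (ℕ; zero; suc; _+_; _*_; _∸_; _≤_; _≡ᵇ_; _≤ᵇ_; _<ᵇ_)
open import Data.Fin using (Fin; toℕ)
open import Data.List using (List; map; allFin)
open import Data.Nat.ListAction using (sum)
open import Data.Product using (Σ; _×_; proj₁; proj₂; ∃)
open import Data.Sum using (_⊎_)
open import Data.Integer using (ℤ; +_)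
open import Data.Rational using (ℚ; _/_)
open import Data.Fin.Permutation using (Permutation′; _⟨$⟩ʳ_)
open import Relation.Binary.PropositionalEquality using (_≡_; _≢_)

Σℕ : (n : ℕ) → (Fin n → ℕ) → ℕ
Σℕ n f = sum (map f (allFin n))

count : (n : ℕ) → (Fin n → Bool) → ℕ
count n p = Σℕ n (λ i → if p i then 1 else 0)

record Graph (n : ℕ) : Set where
  field
    E     : Fin n → Fin n → Bool
    sym   : ∀ u v → E u v ≡ E v u
    irrefl : ∀ u → E u u ≡ false
open Graph public

edgeCount : ∀ {n} → Graph n → ℕ
edgeCount {n} G = Σℕ n (λ u → count n (λ v → (toℕ u <ᵇ toℕ v) ∧ E G u v))

data Reach {n : ℕ} (G : Graph n) : Fin n → Fin n → Set where
  here : ∀ {u} → Reach G u u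
  step : ∀ {u v w} → E G u v ≡ true → Reach G v w → Reach G u w

Connected : ∀ {n} → Graph n → Set
Connected {n} G = ∀ (u v : Fin n) → Reach G u v

ConnectedUnicyclic : ∀ {n} → Graph n → Set
ConnectedUnicyclic {n} G = Connected G × edgeCount G ≡ n

IsMatching : ∀ {n} → Graph n → {k : ℕ} → (Fin k → Fin n × Fin n) → Set
IsMatching G {k} M =
  (∀ i → E G (proj₁ (M i)) (proj₂ (M i)) ≡ true) ×
  (∀ i j → i ≢ j →
     (proj₁ (M i) ≢ proj₁ (M j)) × (proj₁ (M i) ≢ proj₂ (M j)) ×
     (proj₂ (M i) ≢ proj₁ (M j)) × (proj₂ (M i) ≢ proj₂ (M j)))

MatchingNumber : ∀ {n} → Graph n → ℕ → Set
MatchingNumber {n} G m =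
  (Σ (Fin m → Fin n × Fin n) λ M → IsMatching G M) ×
  (∀ (k : ℕ) (M : Fin k → Fin n × Fin n) → IsMatching G M → k ≤ m)

Digraph : ℕ → Set
Digraph n = Fin n → Fin n → Bool

IsOrientation : ∀ {n} → Graph n → Digraph n → Set
IsOrientation G A =
  (∀ u v → E G u v ≡ (A u v ∨ A v u)) ×
  (∀ u v → A u v ≡ true → A v u ≡ false)

outdeg : ∀ {n} → Digraph n → Fin n → ℕ
outdeg {n} A u = count n (λ v → A u v)

indeg : ∀ {n} → Digraph n → Fin n → ℕ
indeg {n} A v = count n (λ u → A u v)

M₁ : ∀ {n} → Digraph n → ℚ
M₁ {n} A = (+ Σℕ n (λ u → Σℕ n (λ v →
              if A u v then outdeg A u + indeg A v else 0))) / 2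

_≅_ : ∀ {n} → Digraph n → Digraph n → Set
_≅_ {n} A B = Σ (Permutation′ n) λ σ → ∀ u v → A u v ≡ B (σ ⟨$⟩ʳ u) (σ ⟨$⟩ʳ v)

onFin : (n : ℕ) → (ℕ → ℕ → Bool) → Digraph n
onFin n R u v = R (toℕ u) (toℕ v)

reverse : (ℕ → ℕ → Bool) → (ℕ → ℕ → Bool)
reverse R i j = R j i

-- The model orientations of U_{n,m}.
-- Labelling of U_{n,m} on {0,…,n-1}:
--   w = 0, a = 1, b = 2;
--   paths w x_j y_j (j = 0..m-3) with x_j = 3+2j, y_j = 4+2j;
--   pendent vertices 2m-1, …, n-1 (n-2m+1 of them) attached to w.

odd : ℕ → Bool
odd zero = false
odd (suc k) = not (odd k)

isX : ℕ → ℕ → Bool   -- isX m j : j is a middle vertex x of an attached path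
isX m j = (3 ≤ᵇ j) ∧ (j ≤ᵇ (2 * m ∸ 3)) ∧ odd j

isY : ℕ → ℕ → Bool   -- isY m j : j is an end vertex y of an attached path
isY m j = (4 ≤ᵇ j) ∧ (j ≤ᵇ (2 * m ∸ 2)) ∧ not (odd j)

-- type (i): all arcs at w leave w, each x has both arcs entering it,
-- flag chooses the direction of ab (true: a→b, false: b→a)
Utype1 : ℕ → Bool → ℕ → ℕ → Bool
Utype1 m flag i j =
  ((i ≡ᵇ 0) ∧ not (j ≡ᵇ 0) ∧ not (isY m j)) ∨
  (isX m j ∧ (i ≡ᵇ suc j)) ∨
  (flag ∧ (i ≡ᵇ 1) ∧ (j ≡ᵇ 2)) ∨
  (not flag ∧ (i ≡ᵇ 2) ∧ (j ≡ᵇ 1))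

-- sink-source orientation of C₄ = 0-1-2-3-0, sources 0 and 2
C4ss : ℕ → ℕ → Bool
C4ss i j = ((i ≡ᵇ 0) ∨ (i ≡ᵇ 2)) ∧ ((j ≡ᵇ 1) ∨ (j ≡ᵇ 3))

-- C₄ = 0-1-2-3-0 with pendent 4 at 0 and pendent 5 at 1;
-- sink-source orientation with sources 0, 2, 5
C4ppss : ℕ → ℕ → Bool
C4ppss i j = C4ss i j ∨ ((i ≡ᵇ 0) ∧ (j ≡ᵇ 4)) ∨ ((i ≡ᵇ 5) ∧ (j ≡ᵇ 1))

InUStar : (n m : ℕ) → Digraph n → Set
InUStar n m D =
  (∃ λ flag → D ≅ onFin n (Utype1 m flag)) ⊎
  (∃ λ flag → D ≅ onFin n (reverse (Utype1 m flag))) ⊎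
  ((n ≡ 4) × (m ≡ 2) × ((D ≅ onFin n C4ss) ⊎ (D ≅ onFin n (reverse C4ss)))) ⊎
  ((n ≡ 6) × (m ≡ 3) × ((D ≅ onFin n C4ppss) ⊎ (D ≅ onFin n (reverse C4ppss))))

{-# OPTIONS --safe #-}
-- Write the edges of a matching of size m as arcs tᵢ → hᵢ and let K be the digraph of the
-- k = n − m other arcs.  As 2 M₁(D) = Σ d⁺² + Σ d⁻², it counts pairs of arcs that share a tail
-- or share a head.  Separating matching arcs from K gives the exact formula
--   2 M₁(D) + (Y + 2 Z) = k² + 3k + 4m,
-- where Y is the number of ordered pairs of arcs of K sharing neither tail nor head and Z counts
-- arcs of K incoherent with an adjacent matching arc, plus the degrees above 1 of unmatched
-- vertices.  The bound says Y + 2 Z ≥ 2, so everything follows from the case Y + 2 Z ≤ 2.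
-- If Y = 0, then K is a star with all arcs leaving (or all entering) one vertex, and counting
-- heads against Z ≤ 1 shows D is of type U¹,…,U⁴.  If Y > 0, then Z = 0, so every vertex is a source
-- or a sink of K; K is a path or a pair of disjoint arcs, which gives the two sporadic graphs.

module Submission where

open import Defs hiding (sym)
open import Data.Bool using (Bool; T; true; false; _∧_; _∨_; not; if_then_else_)
open import Data.Nat using (ℕ; zero; suc; _+_; _*_; _∸_; _≤_; _<_; z≤n; s≤s; _≤?_; _≡ᵇ_; _≤ᵇ_; _<ᵇ_)
open import Data.Nat.Properties hiding (_≟_; suc-injective)
open import Data.Nat.Tactic.RingSolver using (solve-∀)
open import Data.Fin using (Fin; zero; suc; toℕ; fromℕ<; punchIn; punchOut; combine; remQuot)
open import Data.Fin.Properties using (injective⇒≤; _≟_; any?; toℕ<n; toℕ-fromℕ<; toℕ-combine; combine-remQuot; remQuot-combine; toℕ-injective; suc-injective; punchOut-injective; punchIn-punchOut)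
open import Data.Fin.Permutation using (Permutation′; _⟨$⟩ʳ_; _⟨$⟩ˡ_; inverseʳ; inverseˡ; insert; insert-punchIn) renaming (id to idₚ; flip to flipₚ)
open import Data.Product using (Σ; _×_; _,_; proj₁; proj₂; ∃; ∃₂)
open import Data.Sum using (_⊎_; inj₁; inj₂)
open import Function using (_∘_; id)
open import Relation.Nullary using (¬_; Dec; yes; no; does; contradiction)
open import Relation.Nullary.Decidable using (dec-true; dec-false; _×-dec_)
open import Relation.Binary.PropositionalEquality using (_≡_; _≢_; refl; sym; trans; cong; cong₂; subst; module ≡-Reasoning)
open import Algebra.Properties.Semiring.Sum +-*-semiring using (sum-cong-≗; ∑-distrib-+; ∑-comm; sum-permute; *-distribˡ-sum; *-distribʳ-sum; sum-replicate-zero) renaming (sum to ∑)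
open import Data.Unit using (tt)
open import Data.Bool.Properties using (∧-zeroʳ; ∧-identityʳ)
open import Data.Vec using (Vec; []; _∷_; lookup)
open import Data.Vec.Relation.Unary.Unique.Propositional using ([]; _∷_)
open import Data.Vec.Relation.Unary.All using ([]; _∷_)
open import Data.Vec.Relation.Unary.Unique.Propositional.Properties using (lookup-injective)
open import Relation.Binary using (tri<; tri≈; tri>)
open import Data.List using (tabulate)
open import Data.List.Properties using (map-tabulate)
open import Data.Nat.ListAction using () renaming (sum to sumᴸ)
open import Data.Product.Properties using (≡-dec)

-- The deficit formula is an identity rather than an estimate, so the bound and its equality case
-- are one statement about `Y + 2 Z`, a number that is the same for every matching of size `m`. The
-- values 0 and 1 are never refuted by themselves: the case analysis puts every orientation with
-- `Y + 2 Z ≤ 2` into the extremal family, and a computation on the models then returns exactly 2.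
-- The threshold 2 separates the cases sharply. An incoherent pair is counted in both orders, so
-- `Y ≤ 2` leaves room for a single one. When `Y = 0`, the condition `Z ≤ 1` leaves the star one
-- wasted arc, and that arc is the one that closes the triangle.

private variable
  m n : ℕ

-- Finite sums

⟦_⟧ : Bool → ℕ
⟦ b ⟧ = if b then 1 else 0

⟦⟧≤1 : ∀ b → ⟦ b ⟧ ≤ 1
⟦⟧≤1 true = ≤-refl
⟦⟧≤1 false = z≤n

⟦⟧≥1 : ∀ {b} → 1 ≤ ⟦ b ⟧ → b ≡ true
⟦⟧≥1 {true} _ = refl

∑-mono : {f g : Fin n → ℕ} → (∀ i → f i ≤ g i) → ∑ f ≤ ∑ g
∑-mono {zero} p = z≤n
∑-mono {suc n} p = +-mono-≤ (p zero) (∑-mono (p ∘ suc))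

∑-const : ∀ n c → ∑ {n} (λ _ → c) ≡ n * c
∑-const zero c = refl
∑-const (suc n) c = cong (c +_) (∑-const n c)

∑-zero : {f : Fin n → ℕ} → (∀ i → f i ≡ 0) → ∑ f ≡ 0
∑-zero {n} p = trans (sum-cong-≗ p) (sum-replicate-zero n)

≤∑ : (f : Fin n → ℕ) (i : Fin n) → f i ≤ ∑ f
≤∑ f zero = m≤m+n _ _
≤∑ f (suc i) = ≤-trans (≤∑ (f ∘ suc) i) (m≤n+m _ _)

∑-pos : (f : Fin n → ℕ) → 1 ≤ ∑ f → ∃ λ i → 1 ≤ f i
∑-pos {suc n} f p with f zero in eq
... | suc _ = zero , subst (1 ≤_) (sym eq) (s≤s z≤n)
... | zero with ∑-pos (f ∘ suc) p
... | i , q = suc i , q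

∑-tight : {f g : Fin n → ℕ} → (∀ i → f i ≤ g i) → ∑ g ≤ ∑ f → ∀ i → f i ≡ g i
∑-tight {suc n} {f} {g} p q = λ where
    zero → ≤-antisym (p zero) (+-cancelʳ-≤ _ _ _ (≤-trans q (+-monoʳ-≤ (f zero) (∑-mono (p ∘ suc)))))
    (suc i) → ∑-tight (p ∘ suc) (+-cancelˡ-≤ _ _ _ (≤-trans q (+-monoˡ-≤ _ (p zero)))) i

Σℕ≡∑ : ∀ n (f : Fin n → ℕ) → Σℕ n f ≡ ∑ f
Σℕ≡∑ n f = trans (cong sumᴸ (map-tabulate id f)) (go n f)
  where
  go : ∀ n (f : Fin n → ℕ) → sumᴸ (tabulate f) ≡ ∑ f
  go zero f = refl
  go (suc n) f = cong (f zero +_) (go n (f ∘ suc))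

δ : Fin n → Fin n → ℕ
δ u v = ⟦ does (u ≟ v) ⟧

δ-refl : (u : Fin n) → δ u u ≡ 1
δ-refl u = cong ⟦_⟧ (dec-true (u ≟ u) refl)

δ-≢ : {u v : Fin n} → u ≢ v → δ u v ≡ 0
δ-≢ {u = u} {v} u≢v = cong ⟦_⟧ (dec-false (u ≟ v) u≢v)

∑-δ : (u : Fin n) (f : Fin n → ℕ) → ∑ (λ v → δ u v * f v) ≡ f u
∑-δ {suc n} zero f = trans (cong₂ _+_ (+-identityʳ (f zero)) (sum-replicate-zero n)) (+-identityʳ (f zero))
∑-δ {suc n} (suc u) f = ∑-δ u (f ∘ suc)

∑-δ₁ : (u : Fin n) → ∑ (δ u) ≡ 1
∑-δ₁ u = trans (sum-cong-≗ (λ v → sym (*-identityʳ (δ u v)))) (∑-δ u (λ _ → 1))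

∑₂ : (Fin m → Fin n → ℕ) → ℕ
∑₂ f = ∑ (λ u → ∑ (f u))

∑₂-cong : {f g : Fin m → Fin n → ℕ} → (∀ u v → f u v ≡ g u v) → ∑₂ f ≡ ∑₂ g
∑₂-cong p = sum-cong-≗ (λ u → sum-cong-≗ (p u))

∑₂-+ : (f g : Fin m → Fin n → ℕ) → ∑₂ (λ u v → f u v + g u v) ≡ ∑₂ f + ∑₂ g
∑₂-+ f g = trans (sum-cong-≗ (λ u → ∑-distrib-+ (f u) (g u))) (∑-distrib-+ (∑ ∘ f) (∑ ∘ g))

∑₂-mono : {f g : Fin m → Fin n → ℕ} → (∀ u v → f u v ≤ g u v) → ∑₂ f ≤ ∑₂ g
∑₂-mono p = ∑-mono (λ u → ∑-mono (p u))

∑₂-pos : (f : Fin m → Fin n → ℕ) → 1 ≤ ∑₂ f → ∃₂ λ u v → 1 ≤ f u v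
∑₂-pos f p with ∑-pos _ p
... | u , q with ∑-pos _ q
... | v , r = u , v , r

∑₂-*ʳ : (f : Fin m → Fin n → ℕ) (c : ℕ) → ∑₂ (λ u v → f u v * c) ≡ ∑₂ f * c
∑₂-*ʳ f c = trans (sum-cong-≗ (λ u → sym (*-distribʳ-sum c (f u)))) (sym (*-distribʳ-sum c (∑ ∘ f)))

Pair : ℕ → Set
Pair n = Fin n × Fin n

δ₂ : Pair n → Fin n → Fin n → ℕ
δ₂ (a , b) u v = δ a u * δ b v

∑₂-δ₂ : (e : Pair n) → ∑₂ (δ₂ e) ≡ 1
∑₂-δ₂ (a , b) = trans (sum-cong-≗ (λ u → trans (sym (*-distribˡ-sum (δ a u) (δ b))) (cong (δ a u *_) (∑-δ₁ b))))
                      (∑-δ a (λ _ → 1))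

δ₂≤1 : (e : Pair n) (u v : Fin n) → δ₂ e u v ≤ 1
δ₂≤1 (a , b) u v = *-mono-≤ (⟦⟧≤1 (does (a ≟ u))) (⟦⟧≤1 (does (b ≟ v)))

δ₂-≢ : {e : Pair n} {u v : Fin n} → e ≢ (u , v) → δ₂ e u v ≡ 0
δ₂-≢ {e = a , b} {u} {v} ne with a ≟ u | b ≟ v
... | yes refl | yes refl = contradiction refl ne
... | yes _ | no _ = refl
... | no _ | _ = refl

-- Truncated subtraction of the unit mass at `e` lowers the sum by at most 1, so some entry stays
-- positive; at `e` itself `q ≤ 1` makes the difference vanish. With `q` the indicator of `K` this
-- yields a second arc.
∑₂-other : (q : Fin n → Fin n → ℕ) (e : Pair n) → (∀ u v → q u v ≤ 1) → 2 ≤ ∑₂ q →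
           ∃₂ λ u v → 1 ≤ q u v × e ≢ (u , v)
∑₂-other {n} q e q≤1 2≤ with ∑₂-pos g (+-cancelʳ-≤ 1 1 (∑₂ g) (begin
      2                                  ≤⟨ 2≤ ⟩
      ∑₂ q                               ≤⟨ ∑₂-mono le ⟩
      ∑₂ (λ u v → g u v + δ₂ e u v)      ≡⟨ ∑₂-+ g (δ₂ e) ⟩
      ∑₂ g + ∑₂ (δ₂ e)                   ≡⟨ cong (∑₂ g +_) (∑₂-δ₂ e) ⟩
      ∑₂ g + 1                           ∎))
  where
  open ≤-Reasoning
  g : Fin n → Fin n → ℕ
  g u v = q u v ∸ δ₂ e u v
  le : ∀ u v → q u v ≤ g u v + δ₂ e u v
  le u v = ≤-trans (m≤n+m∸n (q u v) (δ₂ e u v)) (≤-reflexive (+-comm (δ₂ e u v) (g u v)))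
... | u , v , p = u , v , ≤-trans p (m∸n≤m (q u v) (δ₂ e u v)) , λ { refl → 1≰0 (begin
      1                          ≤⟨ p ⟩
      q u v ∸ δ u u * δ v v      ≡⟨ cong (q u v ∸_) (cong₂ _*_ (δ-refl u) (δ-refl v)) ⟩
      q u v ∸ 1                  ≤⟨ ∸-monoˡ-≤ 1 (q≤1 u v) ⟩
      0                          ∎) }
  where
  open ≤-Reasoning
  1≰0 : ¬ 1 ≤ 0
  1≰0 ()

pair? : (e f : Pair n) → Dec (e ≡ f)
pair? = ≡-dec _≟_ _≟_

δ₂-self : (e : Pair n) → 1 ≤ δ₂ e (proj₁ e) (proj₂ e)
δ₂-self (a , b) = ≤-reflexive (sym (cong₂ _*_ (δ-refl a) (δ-refl b)))

-- The indicators of three distinct pairs add up to a matrix below `q`. Applied to clash counts, it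
-- turns three clashing arcs into `3 ≤ clashes K`.
∑₂-three : (q : Fin n → Fin n → ℕ) {a b c d x y : Fin n} → 1 ≤ q a b → 1 ≤ q c d → 1 ≤ q x y →
           (a , b) ≢ (c , d) → (a , b) ≢ (x , y) → (c , d) ≢ (x , y) → 3 ≤ ∑₂ q
∑₂-three {n} q {a} {b} {c} {d} {x} {y} p₁ p₂ p₃ n₁₂ n₁₃ n₂₃ = begin
    3                                                 ≡⟨ sym (cong₂ _+_ (∑₂-δ₂ (a , b)) (cong₂ _+_ (∑₂-δ₂ (c , d)) (∑₂-δ₂ (x , y)))) ⟩
    ∑₂ A + (∑₂ B + ∑₂ C)                              ≡⟨ cong (∑₂ A +_) (sym (∑₂-+ B C)) ⟩
    ∑₂ A + ∑₂ (λ u v → B u v + C u v)                 ≡⟨ sym (∑₂-+ A _) ⟩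
    ∑₂ (λ u v → A u v + (B u v + C u v))              ≤⟨ ∑₂-mono le ⟩
    ∑₂ q                                              ∎
  where
  open ≤-Reasoning
  A B C : Fin n → Fin n → ℕ
  A = δ₂ (a , b)
  B = δ₂ (c , d)
  C = δ₂ (x , y)
  le : ∀ u v → A u v + (B u v + C u v) ≤ q u v
  le u v with pair? (a , b) (u , v) | pair? (c , d) (u , v) | pair? (x , y) (u , v)
  ... | yes refl | yes refl | _ = contradiction refl n₁₂
  ... | yes refl | _ | yes refl = contradiction refl n₁₃
  ... | _ | yes refl | yes refl = contradiction refl n₂₃
  ... | yes refl | no n₂ | no n₃
      rewrite δ₂-≢ n₂ | δ₂-≢ n₃ = ≤-trans (≤-reflexive (+-identityʳ _)) (≤-trans (δ₂≤1 (a , b) a b) p₁)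
  ... | no n₁ | yes refl | no n₃
      rewrite δ₂-≢ n₁ | δ₂-≢ n₃ = ≤-trans (≤-reflexive (+-identityʳ _)) (≤-trans (δ₂≤1 (c , d) c d) p₂)
  ... | no n₁ | no n₂ | yes refl
      rewrite δ₂-≢ n₁ | δ₂-≢ n₂ = ≤-trans (δ₂≤1 (x , y) x y) p₃
  ... | no n₁ | no n₂ | no n₃
      rewrite δ₂-≢ n₁ | δ₂-≢ n₂ | δ₂-≢ n₃ = z≤n

-- Degrees and coherent pairs of arcs

arcs : Digraph n → ℕ
arcs A = ∑₂ (λ u v → ⟦ A u v ⟧)

d⁺ d⁻ : Digraph n → Fin n → ℕ
d⁺ A u = ∑ (λ v → ⟦ A u v ⟧)
d⁻ A v = ∑ (λ u → ⟦ A u v ⟧)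

∑d⁻ : (A : Digraph n) → ∑ (d⁻ A) ≡ arcs A
∑d⁻ A = ∑-comm (λ v u → ⟦ A u v ⟧)

zagreb : Digraph n → ℕ
zagreb A = ∑₂ (λ u v → ⟦ A u v ⟧ * (d⁺ A u + d⁻ A v))

squareSum : Digraph n → ℕ
squareSum A = ∑ (λ u → d⁺ A u * d⁺ A u + d⁻ A u * d⁻ A u)

-- Each arc contributes the out-degree of its tail and the in-degree of its head; collecting by
-- tails and by heads produces the squares.
zagreb-squares : (A : Digraph n) → zagreb A ≡ squareSum A
zagreb-squares A = begin
  zagreb A
    ≡⟨ ∑₂-cong (λ u v → *-distribˡ-+ ⟦ A u v ⟧ (d⁺ A u) (d⁻ A v)) ⟩
  ∑₂ (λ u v → ⟦ A u v ⟧ * d⁺ A u + ⟦ A u v ⟧ * d⁻ A v)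
    ≡⟨ ∑₂-+ (λ u v → ⟦ A u v ⟧ * d⁺ A u) (λ u v → ⟦ A u v ⟧ * d⁻ A v) ⟩
  ∑₂ (λ u v → ⟦ A u v ⟧ * d⁺ A u) + ∑₂ (λ u v → ⟦ A u v ⟧ * d⁻ A v)
    ≡⟨ cong₂ _+_ (sum-cong-≗ (λ u → sym (*-distribʳ-sum (d⁺ A u) (λ v → ⟦ A u v ⟧))))
                 (trans (∑-comm (λ u v → ⟦ A u v ⟧ * d⁻ A v)) (sum-cong-≗ (λ v → sym (*-distribʳ-sum (d⁻ A v) (λ u → ⟦ A u v ⟧))))) ⟩
  ∑ (λ u → d⁺ A u * d⁺ A u) + ∑ (λ u → d⁻ A u * d⁻ A u)
    ≡⟨ sym (∑-distrib-+ (λ u → d⁺ A u * d⁺ A u) (λ u → d⁻ A u * d⁻ A u)) ⟩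
  squareSum A ∎
  where open ≡-Reasoning

transpose : Digraph n → Digraph n
transpose A u v = A v u

zagreb-transpose : (A : Digraph n) → zagreb (transpose A) ≡ zagreb A
zagreb-transpose A = trans (∑-comm (λ u v → ⟦ A v u ⟧ * (d⁻ A u + d⁺ A v)))
  (∑₂-cong (λ u v → cong (⟦ A u v ⟧ *_) (+-comm (d⁻ A v) (d⁺ A u))))

-- Two arcs are coherent when they share their tail or their head; clash K u v counts
-- the arcs of K that are not coherent with u → v.
Coherent : Digraph n → Set
Coherent K = ∀ {u v x y} → K u v ≡ true → K x y ≡ true → u ≡ x ⊎ v ≡ y

clash : Digraph n → Fin n → Fin n → ℕ
clash K u v = ∑₂ (λ x y → ⟦ K x y ∧ not (does (u ≟ x)) ∧ not (does (v ≟ y)) ⟧)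

-- Inclusion-exclusion over the arcs `x → y` of `K`: those with tail `u`, those with head `v` and
-- those with neither cover all arcs, and only `u → v` itself, if it is an arc, is counted twice.
clash-deg : (K : Digraph n) (u v : Fin n) → d⁺ K u + d⁻ K v + clash K u v ≡ arcs K + ⟦ K u v ⟧
clash-deg K u v = begin
  d⁺ K u + d⁻ K v + clash K u v
    ≡⟨ cong (λ s → s + clash K u v) (cong₂ _+_ row col) ⟨
  ∑₂ (λ x y → δ u x * ⟦ K x y ⟧) + ∑₂ (λ x y → δ v y * ⟦ K x y ⟧) + clash K u v
    ≡⟨ cong (_+ clash K u v) (∑₂-+ (λ x y → δ u x * ⟦ K x y ⟧) (λ x y → δ v y * ⟦ K x y ⟧)) ⟨
  ∑₂ (λ x y → δ u x * ⟦ K x y ⟧ + δ v y * ⟦ K x y ⟧) + clash K u v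
    ≡⟨ ∑₂-+ (λ x y → δ u x * ⟦ K x y ⟧ + δ v y * ⟦ K x y ⟧) _ ⟨
  ∑₂ (λ x y → δ u x * ⟦ K x y ⟧ + δ v y * ⟦ K x y ⟧ + ⟦ K x y ∧ not (does (u ≟ x)) ∧ not (does (v ≟ y)) ⟧)
    ≡⟨ ∑₂-cong (λ x y → incl-excl (does (u ≟ x)) (does (v ≟ y)) (K x y)) ⟩
  ∑₂ (λ x y → ⟦ K x y ⟧ + δ u x * (δ v y * ⟦ K x y ⟧))
    ≡⟨ ∑₂-+ (λ x y → ⟦ K x y ⟧) (λ x y → δ u x * (δ v y * ⟦ K x y ⟧)) ⟩
  arcs K + ∑₂ (λ x y → δ u x * (δ v y * ⟦ K x y ⟧))
    ≡⟨ cong (arcs K +_) (trans (sum-cong-≗ (λ x → trans (sym (*-distribˡ-sum (δ u x) (λ y → δ v y * ⟦ K x y ⟧))) (cong (δ u x *_) (∑-δ v (λ y → ⟦ K x y ⟧)))))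
                               (∑-δ u (λ x → ⟦ K x v ⟧))) ⟩
  arcs K + ⟦ K u v ⟧ ∎
  where
  open ≡-Reasoning
  incl-excl : ∀ p q r → ⟦ p ⟧ * ⟦ r ⟧ + ⟦ q ⟧ * ⟦ r ⟧ + ⟦ r ∧ not p ∧ not q ⟧ ≡ ⟦ r ⟧ + ⟦ p ⟧ * (⟦ q ⟧ * ⟦ r ⟧)
  incl-excl false false false = refl
  incl-excl false false true = refl
  incl-excl false true false = refl
  incl-excl false true true = refl
  incl-excl true false false = refl
  incl-excl true false true = refl
  incl-excl true true false = refl
  incl-excl true true true = refl
  row : ∑₂ (λ x y → δ u x * ⟦ K x y ⟧) ≡ d⁺ K u
  row = trans (sum-cong-≗ (λ x → sym (*-distribˡ-sum (δ u x) (λ y → ⟦ K x y ⟧)))) (∑-δ u (d⁺ K))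
  col : ∑₂ (λ x y → δ v y * ⟦ K x y ⟧) ≡ d⁻ K v
  col = sum-cong-≗ (λ x → ∑-δ v (λ y → ⟦ K x y ⟧))

clashes : Digraph n → ℕ
clashes K = ∑₂ (λ u v → ⟦ K u v ⟧ * clash K u v)

-- Summation of `clash-deg` over the arcs of `K`, where the correction `⟦ K u v ⟧` is 1. Pairwise
-- coherent arcs attain the product on the right; each ordered incoherent pair costs 1.
zagreb-clashes : (K : Digraph n) → zagreb K + clashes K ≡ arcs K * suc (arcs K)
zagreb-clashes K = begin
  zagreb K + clashes K
    ≡⟨ ∑₂-+ (λ u v → ⟦ K u v ⟧ * (d⁺ K u + d⁻ K v)) (λ u v → ⟦ K u v ⟧ * clash K u v) ⟨
  ∑₂ (λ u v → ⟦ K u v ⟧ * (d⁺ K u + d⁻ K v) + ⟦ K u v ⟧ * clash K u v)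
    ≡⟨ ∑₂-cong (λ u v → trans (sym (*-distribˡ-+ ⟦ K u v ⟧ (d⁺ K u + d⁻ K v) (clash K u v)))
                              (trans (cong (⟦ K u v ⟧ *_) (clash-deg K u v)) (idem (K u v)))) ⟩
  ∑₂ (λ u v → ⟦ K u v ⟧ * suc (arcs K))
    ≡⟨ ∑₂-*ʳ (λ u v → ⟦ K u v ⟧) (suc (arcs K)) ⟩
  arcs K * suc (arcs K) ∎
  where
  open ≡-Reasoning
  idem : ∀ b → ⟦ b ⟧ * (arcs K + ⟦ b ⟧) ≡ ⟦ b ⟧ * suc (arcs K)
  idem true = cong (_+ 0) (+-comm (arcs K) 1)
  idem false = refl

clash-≥1 : (K : Digraph n) {u v x y : Fin n} → K x y ≡ true → u ≢ x → v ≢ y → 1 ≤ clash K u v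
clash-≥1 K {u} {v} {x} {y} kxy u≢x v≢y =
  ≤-trans (≤-reflexive (sym one)) (≤-trans (≤∑ (h x) y) (≤∑ (λ x → ∑ (h x)) x))
  where
  h : _ → _ → ℕ
  h x y = ⟦ K x y ∧ not (does (u ≟ x)) ∧ not (does (v ≟ y)) ⟧
  one : h x y ≡ 1
  one rewrite kxy | dec-false (u ≟ x) u≢x | dec-false (v ≟ y) v≢y = refl

clash-witness : (K : Digraph n) (u v : Fin n) → 1 ≤ clash K u v → ∃₂ λ x y → K x y ≡ true × u ≢ x × v ≢ y
clash-witness K u v p with ∑₂-pos _ p
... | x , y , q with K x y in kxy | u ≟ x | v ≟ y
... | true | no u≢x | no v≢y = x , y , kxy , u≢x , v≢y

≡true? : ∀ b → Dec (b ≡ true)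
≡true? true = yes refl
≡true? false = no λ ()

-- Relabelling

-- Induction on `m`: `zero` goes to `ι zero`, and `punchOut` removes that value from the range of
-- the rest. Comparing by `toℕ` avoids an explicit embedding of `Fin m` into `Fin n`; where the
-- labels from `m` on land is left open.
completion : (ι : Fin m → Fin n) → (∀ {i j} → ι i ≡ ι j → i ≡ j) →
             Σ (Permutation′ n) λ π → ∀ i j → toℕ i ≡ toℕ j → π ⟨$⟩ʳ j ≡ ι i
completion {zero} ι inj = idₚ , λ ()
completion {suc m} {zero} ι inj with ι zero
... | ()
completion {suc m} {suc n} ι inj = insert zero (ι zero) π , extends
  where
  0≢ : ∀ i → ι zero ≢ ι (suc i)
  0≢ i eq with inj eq
  ... | ()
  rec = completion (λ i → punchOut (0≢ i)) (λ {i} {j} eq → suc-injective (inj (punchOut-injective (0≢ i) (0≢ j) eq)))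
  π = proj₁ rec
  extends : ∀ i j → toℕ i ≡ toℕ j → insert zero (ι zero) π ⟨$⟩ʳ j ≡ ι i
  extends zero zero _ = refl
  extends (suc i) (suc j) eq =
    trans (insert-punchIn zero (ι zero) π j)
          (trans (cong (punchIn (ι zero)) (proj₂ rec i j (suc-injective′ eq))) (punchIn-punchOut (0≢ i)))
    where
    suc-injective′ : ∀ {a b} → suc a ≡ suc b → a ≡ b
    suc-injective′ refl = refl

∑₂-permute : (f : Fin n → Fin n → ℕ) (π : Permutation′ n) → ∑₂ f ≡ ∑₂ (λ u v → f (π ⟨$⟩ʳ u) (π ⟨$⟩ʳ v))
∑₂-permute f π = trans (sum-permute (λ u → ∑ (f u)) π) (sum-cong-≗ (λ u → sum-permute (f (π ⟨$⟩ʳ u)) π))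

zagreb-≅ : {A B : Digraph n} → A ≅ B → zagreb A ≡ zagreb B
zagreb-≅ {A = A} {B} (σ , iso) = trans
  (∑₂-cong (λ u v → cong₂ _*_ (cong ⟦_⟧ (iso u v)) (cong₂ _+_ (out u) (inn v))))
  (sym (∑₂-permute (λ u v → ⟦ B u v ⟧ * (d⁺ B u + d⁻ B v)) σ))
  where
  out : ∀ u → d⁺ A u ≡ d⁺ B (σ ⟨$⟩ʳ u)
  out u = trans (sum-cong-≗ (λ v → cong ⟦_⟧ (iso u v))) (sym (sum-permute (λ v → ⟦ B (σ ⟨$⟩ʳ u) v ⟧) σ))
  inn : ∀ v → d⁻ A v ≡ d⁻ B (σ ⟨$⟩ʳ v)
  inn v = trans (sum-cong-≗ (λ u → cong ⟦_⟧ (iso u v))) (sym (sum-permute (λ u → ⟦ B u (σ ⟨$⟩ʳ v) ⟧) σ))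

-- Equal arc counts turn a one-sided homomorphism into an isomorphism.
≅-from-arcs : (A B : Digraph n) (π : Permutation′ n) →
              (∀ i j → B i j ≡ true → A (π ⟨$⟩ʳ i) (π ⟨$⟩ʳ j) ≡ true) → arcs A ≤ arcs B → A ≅ B
≅-from-arcs {n} A B π maps A≤B = flipₚ π , λ u v →
    trans (cong₂ A (sym (inverseʳ π)) (sym (inverseʳ π))) (sym (⟦⟧-injective (same (π ⟨$⟩ˡ u) (π ⟨$⟩ˡ v))))
  where
  A′ : Digraph n
  A′ i j = A (π ⟨$⟩ʳ i) (π ⟨$⟩ʳ j)
  ⟦⟧-injective : ∀ {a b} → ⟦ a ⟧ ≡ ⟦ b ⟧ → a ≡ b
  ⟦⟧-injective {true} {true} _ = refl
  ⟦⟧-injective {false} {false} _ = refl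
  le : ∀ i j → ⟦ B i j ⟧ ≤ ⟦ A′ i j ⟧
  le i j with B i j in eq
  ... | false = z≤n
  ... | true = ≤-reflexive (cong ⟦_⟧ (sym (maps i j eq)))
  A′≤B : arcs A′ ≤ arcs B
  A′≤B = ≤-trans (≤-reflexive (sym (∑₂-permute (λ u v → ⟦ A u v ⟧) π))) A≤B
  same : ∀ i j → ⟦ B i j ⟧ ≡ ⟦ A′ i j ⟧
  same i = ∑-tight (le i) (≤-reflexive (sym (∑-tight (λ i → ∑-mono (le i)) A′≤B i)))

-- Splitting off a matching and the deficit formula

excess : ℕ → ℕ → ℕ
excess k m = k * k + 3 * k + 4 * m

-- A matching of m arcs tᵢ → hᵢ of A, together with the digraph K of the remaining arcs.
record Split (A : Digraph n) (m : ℕ) : Set where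
  field
    K      : Digraph n
    t h    : Fin m → Fin n
    t-inj  : ∀ {i j} → t i ≡ t j → i ≡ j
    h-inj  : ∀ {i j} → h i ≡ h j → i ≡ j
    t≢h    : ∀ i j → t i ≢ h j
    -- One equation of indicators says that the matching arcs belong to `A`, that `K` avoids them
    -- and that together they exhaust `A`; in this form it sums directly to degrees.
    split  : ∀ u v → ⟦ A u v ⟧ ≡ ⟦ K u v ⟧ + ∑ (λ i → δ₂ (t i , h i) u v)

  -- Indicators of the matched tails, the matched heads and the unmatched vertices. Injectivity of
  -- `t` and `h` together with `t≢h` makes exactly one of them 1 at each vertex, so the truncated
  -- subtraction is exact.
  τ η υ : Fin n → ℕ
  τ u = ∑ (λ i → δ (t i) u)
  η u = ∑ (λ i → δ (h i) u)
  υ u = 1 ∸ (τ u + η u)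

  K⇒A : ∀ {u v} → K u v ≡ true → A u v ≡ true
  K⇒A {u} {v} k = ⟦⟧≥1 (≤-trans (≤-reflexive (sym (cong ⟦_⟧ k))) (≤-trans (m≤m+n _ _) (≤-reflexive (sym (split u v)))))

  private
    one : ∀ i → 1 ≤ ∑ (λ j → δ₂ (t j , h j) (t i) (h i))
    one i = ≤-trans (≤-reflexive (sym (cong₂ _*_ (δ-refl (t i)) (δ-refl (h i))))) (≤∑ (λ j → δ₂ (t j , h j) (t i) (h i)) i)

  matched : ∀ i → A (t i) (h i) ≡ true
  matched i = ⟦⟧≥1 (≤-trans (one i) (≤-trans (m≤n+m _ _) (≤-reflexive (sym (split (t i) (h i))))))

  K-matched : ∀ i → K (t i) (h i) ≢ true
  K-matched i k = 2≰1 (≤-trans (+-mono-≤ (≤-reflexive (sym (cong ⟦_⟧ k))) (one i))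
                        (≤-trans (≤-reflexive (sym (split (t i) (h i)))) (⟦⟧≤1 (A (t i) (h i)))))
    where
    2≰1 : ¬ 2 ≤ 1
    2≰1 (s≤s ())

  data Kind (u : Fin n) : Set where
    tail : ∀ i → t i ≡ u → Kind u
    head : ∀ i → h i ≡ u → Kind u
    free : (∀ i → t i ≢ u) → (∀ i → h i ≢ u) → Kind u

  kind : ∀ u → Kind u
  kind u with any? (λ i → t i ≟ u) | any? (λ i → h i ≟ u)
  ... | yes (i , p) | _ = tail i p
  ... | no _ | yes (i , p) = head i p
  ... | no p | no q = free (λ i e → p (i , e)) (λ i e → q (i , e))

  private
    hit : (f : Fin m → Fin n) → (∀ {i j} → f i ≡ f j → i ≡ j) → ∀ i → ∑ (λ j → δ (f j) (f i)) ≡ 1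
    hit f inj i = trans (sum-cong-≗ same) (∑-δ₁ i)
      where
      same : ∀ j → δ (f j) (f i) ≡ δ i j
      same j with i ≟ j
      ... | yes refl = δ-refl (f i)
      ... | no i≢j = δ-≢ (λ e → i≢j (sym (inj e)))

  τ-tail : ∀ i → τ (t i) ≡ 1
  τ-tail = hit t t-inj

  η-head : ∀ i → η (h i) ≡ 1
  η-head = hit h h-inj

  τ-other : ∀ {u} → (∀ i → t i ≢ u) → τ u ≡ 0
  τ-other p = ∑-zero (λ i → δ-≢ (p i))

  η-other : ∀ {u} → (∀ i → h i ≢ u) → η u ≡ 0
  η-other p = ∑-zero (λ i → δ-≢ (p i))

  τ-head : ∀ i → τ (h i) ≡ 0
  τ-head i = τ-other (λ j → t≢h j i)

  η-tail : ∀ i → η (t i) ≡ 0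
  η-tail i = η-other (λ j e → t≢h i j (sym e))

  υ-free : ∀ {u} → (∀ i → t i ≢ u) → (∀ i → h i ≢ u) → υ u ≡ 1
  υ-free p q = cong (1 ∸_) (cong₂ _+_ (τ-other p) (η-other q))

  υ-tail : ∀ i → υ (t i) ≡ 0
  υ-tail i = cong (1 ∸_) (cong₂ _+_ (τ-tail i) (η-tail i))

  υ-head : ∀ i → υ (h i) ≡ 0
  υ-head i = cong (1 ∸_) (cong₂ _+_ (τ-head i) (η-head i))

  τηυ : ∀ u → τ u + η u + υ u ≡ 1
  τηυ u with kind u
  ... | tail i refl = cong₂ _+_ (cong₂ _+_ (τ-tail i) (η-tail i)) (υ-tail i)
  ... | head i refl = cong₂ _+_ (cong₂ _+_ (τ-head i) (η-head i)) (υ-head i)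
  ... | free p q = cong₂ _+_ (cong₂ _+_ (τ-other p) (η-other q)) (υ-free p q)

  private
    ∑-hits : (f : Fin m → Fin n) → ∑ (λ u → ∑ (λ i → δ (f i) u)) ≡ m
    ∑-hits f = trans (∑-comm (λ u i → δ (f i) u))
                     (trans (sum-cong-≗ (λ i → ∑-δ₁ (f i))) (trans (∑-const m 1) (*-identityʳ m)))

  ∑τ : ∑ τ ≡ m
  ∑τ = ∑-hits t

  ∑η : ∑ η ≡ m
  ∑η = ∑-hits h

  ∑υ : ∑ υ + (m + m) ≡ n
  ∑υ = begin
    ∑ υ + (m + m)                     ≡⟨ +-comm (∑ υ) (m + m) ⟩
    m + m + ∑ υ                       ≡⟨ cong (_+ ∑ υ) (cong₂ _+_ ∑τ ∑η) ⟨
    ∑ τ + ∑ η + ∑ υ                   ≡⟨ cong (_+ ∑ υ) (∑-distrib-+ τ η) ⟨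
    ∑ (λ u → τ u + η u) + ∑ υ         ≡⟨ ∑-distrib-+ (λ u → τ u + η u) υ ⟨
    ∑ (λ u → τ u + η u + υ u)         ≡⟨ sum-cong-≗ τηυ ⟩
    ∑ {n} (λ _ → 1)                   ≡⟨ trans (∑-const n 1) (*-identityʳ n) ⟩
    n                                 ∎
    where open ≡-Reasoning

  d⁺-split : ∀ u → d⁺ A u ≡ d⁺ K u + τ u
  d⁺-split u = begin
    d⁺ A u
      ≡⟨ sum-cong-≗ (split u) ⟩
    ∑ (λ v → ⟦ K u v ⟧ + ∑ (λ i → δ (t i) u * δ (h i) v))
      ≡⟨ ∑-distrib-+ (λ v → ⟦ K u v ⟧) _ ⟩
    d⁺ K u + ∑ (λ v → ∑ (λ i → δ (t i) u * δ (h i) v))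
      ≡⟨ cong (d⁺ K u +_) (∑-comm (λ v i → δ (t i) u * δ (h i) v)) ⟩
    d⁺ K u + ∑ (λ i → ∑ (λ v → δ (t i) u * δ (h i) v))
      ≡⟨ cong (d⁺ K u +_) (sum-cong-≗ (λ i → trans (sym (*-distribˡ-sum (δ (t i) u) (δ (h i))))
                                             (trans (cong (δ (t i) u *_) (∑-δ₁ (h i))) (*-identityʳ _)))) ⟩
    d⁺ K u + τ u ∎
    where open ≡-Reasoning

-- Reversing all arcs exchanges tails and heads, so that statements about in-degrees and in-stars
-- follow from those about out-degrees and out-stars.
transposeSplit : {A : Digraph n} → Split A m → Split (transpose A) m
transposeSplit S = record
  { K = transpose K ; t = h ; h = t ; t-inj = h-inj ; h-inj = t-inj
  ; t≢h = λ i j e → t≢h j i (sym e)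
  ; split = λ u v → trans (split v u) (cong (⟦ K v u ⟧ +_) (sum-cong-≗ (λ i → *-comm (δ (t i) v) (δ (h i) u))))
  }
  where open Split S

module _ {A : Digraph n} (S : Split A m) where
  open Split S

  d⁻-split : ∀ v → d⁻ A v ≡ d⁻ K v + η v
  d⁻-split = Split.d⁺-split (transposeSplit S)

  arcs-split : arcs A ≡ arcs K + m
  arcs-split = trans (sum-cong-≗ d⁺-split) (trans (∑-distrib-+ (d⁺ K) τ) (cong (arcs K +_) ∑τ))

  -- K-arcs pointing against the matching arc of their endpoint, and all but one of the
  -- arcs at an unmatched vertex.
  waste : Fin n → ℕ
  waste u = d⁺ K u * η u + d⁻ K u * τ u + υ u * (d⁺ K u + d⁻ K u ∸ 1)

  waste-head : ∀ i → waste (h i) ≡ d⁺ K (h i)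
  waste-head i rewrite η-head i | τ-head i | *-identityʳ (d⁺ K (h i)) | *-zeroʳ (d⁻ K (h i)) =
    trans (+-identityʳ _) (+-identityʳ _)

  waste-tail : ∀ i → waste (t i) ≡ d⁻ K (t i)
  waste-tail i rewrite η-tail i | τ-tail i | *-identityʳ (d⁻ K (t i)) | *-zeroʳ (d⁺ K (t i)) = +-identityʳ _

  waste-free : ∀ {u} → (∀ i → t i ≢ u) → (∀ i → h i ≢ u) → waste u ≡ d⁺ K u + d⁻ K u ∸ 1
  waste-free {u} p q rewrite η-other q | τ-other p | *-zeroʳ (d⁺ K u) | *-zeroʳ (d⁻ K u) = +-identityʳ _

  -- Let `a` and `b` be the out- and in-degree in `K`. At a matched tail `(a + 1)² = a² + 2a + 1`,
  -- and the waste `b` supplies the missing `2b`; heads are symmetric. At an unmatched vertex the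
  -- waste `a + b ∸ 1` supplies all of `2 (a + b)` but 2, which is the summand `2 * υ u`; positive
  -- degree makes the subtraction exact.
  squares-waste : (∀ u → 1 ≤ d⁺ A u + d⁻ A u) → ∀ u →
    d⁺ A u * d⁺ A u + d⁻ A u * d⁻ A u + 2 * waste u + 2 * υ u
      ≡ d⁺ K u * d⁺ K u + d⁻ K u * d⁻ K u + 2 * (d⁺ K u + d⁻ K u) + (τ u + η u)
  squares-waste deg≥1 u with kind u
  ... | tail i refl rewrite waste-tail i | υ-tail i | d⁺-split (t i) | d⁻-split (t i) | τ-tail i | η-tail i =
        eq (d⁺ K (t i)) (d⁻ K (t i))
    where
    eq : ∀ a b → (a + 1) * (a + 1) + (b + 0) * (b + 0) + 2 * b + 0 ≡ a * a + b * b + 2 * (a + b) + 1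
    eq = solve-∀
  ... | head i refl rewrite waste-head i | υ-head i | d⁺-split (h i) | d⁻-split (h i) | τ-head i | η-head i =
        eq (d⁺ K (h i)) (d⁻ K (h i))
    where
    eq : ∀ a b → (a + 0) * (a + 0) + (b + 1) * (b + 1) + 2 * a + 0 ≡ a * a + b * b + 2 * (a + b) + 1
    eq = solve-∀
  ... | free p q rewrite waste-free p q | υ-free p q | d⁺-split u | d⁻-split u | τ-other p | η-other q =
        trans (eq a b (a + b ∸ 1)) (cong (λ s → a * a + b * b + 2 * s + 0) (m∸n+n≡m pos))
    where
    a = d⁺ K u
    b = d⁻ K u
    eq : ∀ a b c → (a + 0) * (a + 0) + (b + 0) * (b + 0) + 2 * c + 2 ≡ a * a + b * b + 2 * (c + 1) + 0
    eq = solve-∀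
    pos : 1 ≤ a + b
    pos = ≤-trans (deg≥1 u) (≤-reflexive (cong₂ _+_ (trans (d⁺-split u) (trans (cong (a +_) (τ-other p)) (+-identityʳ a)))
                                                    (trans (d⁻-split u) (trans (cong (b +_) (η-other q)) (+-identityʳ b)))))

  zagreb-deficit : (∀ u → 1 ≤ d⁺ A u + d⁻ A u) → arcs A ≡ n →
    zagreb A + (clashes K + 2 * ∑ waste) ≡ excess (arcs K) m
  -- Adding `2 * n` to both sides keeps the computation free of subtraction: on the left `n` is read
  -- as `∑ υ + (m + m)`, on the right as `arcs K + m`.
  zagreb-deficit deg≥1 size = +-cancelʳ-≡ (2 * n) _ _ (begin
    zagreb A + (Y + 2 * Z) + 2 * n
      ≡⟨ cong (λ s → zagreb A + (Y + 2 * Z) + 2 * s) ∑υ ⟨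
    zagreb A + (Y + 2 * Z) + 2 * (V + (m + m))
      ≡⟨ e₁ (zagreb A) Y Z V m ⟩
    zagreb A + 2 * Z + 2 * V + Y + 4 * m
      ≡⟨ cong (λ s → s + Y + 4 * m) total ⟩
    zagreb K + 2 * (k + k) + (m + m) + Y + 4 * m
      ≡⟨ e₂ (zagreb K) k Y m ⟩
    zagreb K + Y + 4 * k + 6 * m
      ≡⟨ cong (λ s → s + 4 * k + 6 * m) (zagreb-clashes K) ⟩
    k * suc k + 4 * k + 6 * m
      ≡⟨ e₃ k m ⟩
    k * k + 3 * k + 4 * m + 2 * (k + m)
      ≡⟨ cong (λ s → k * k + 3 * k + 4 * m + 2 * s) (trans (sym arcs-split) size) ⟩
    excess k m + 2 * n ∎)
    where
    open ≡-Reasoning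
    k = arcs K
    Y = clashes K
    Z = ∑ waste
    V = ∑ υ
    e₁ : ∀ f y z v m → f + (y + 2 * z) + 2 * (v + (m + m)) ≡ f + 2 * z + 2 * v + y + 4 * m
    e₁ = solve-∀
    e₂ : ∀ f k y m → f + 2 * (k + k) + (m + m) + y + 4 * m ≡ f + y + 4 * k + 6 * m
    e₂ = solve-∀
    e₃ : ∀ k m → k * suc k + 4 * k + 6 * m ≡ k * k + 3 * k + 4 * m + 2 * (k + m)
    e₃ = solve-∀
    sqA sqK : Fin n → ℕ
    sqA u = d⁺ A u * d⁺ A u + d⁻ A u * d⁻ A u
    sqK u = d⁺ K u * d⁺ K u + d⁻ K u * d⁻ K u
    total : zagreb A + 2 * Z + 2 * V ≡ zagreb K + 2 * (k + k) + (m + m)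
    total = begin
      zagreb A + 2 * Z + 2 * V
        ≡⟨ cong₂ _+_ (cong₂ _+_ (zagreb-squares A) (*-distribˡ-sum 2 waste)) (*-distribˡ-sum 2 υ) ⟩
      ∑ sqA + ∑ (λ u → 2 * waste u) + ∑ (λ u → 2 * υ u)
        ≡⟨ cong (_+ ∑ (λ u → 2 * υ u)) (∑-distrib-+ sqA (λ u → 2 * waste u)) ⟨
      ∑ (λ u → sqA u + 2 * waste u) + ∑ (λ u → 2 * υ u)
        ≡⟨ ∑-distrib-+ (λ u → sqA u + 2 * waste u) (λ u → 2 * υ u) ⟨
      ∑ (λ u → sqA u + 2 * waste u + 2 * υ u)
        ≡⟨ sum-cong-≗ (squares-waste deg≥1) ⟩
      ∑ (λ u → sqK u + 2 * (d⁺ K u + d⁻ K u) + (τ u + η u))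
        ≡⟨ ∑-distrib-+ (λ u → sqK u + 2 * (d⁺ K u + d⁻ K u)) (λ u → τ u + η u) ⟩
      ∑ (λ u → sqK u + 2 * (d⁺ K u + d⁻ K u)) + ∑ (λ u → τ u + η u)
        ≡⟨ cong₂ _+_ (∑-distrib-+ sqK (λ u → 2 * (d⁺ K u + d⁻ K u))) (∑-distrib-+ τ η) ⟩
      ∑ sqK + ∑ (λ u → 2 * (d⁺ K u + d⁻ K u)) + (∑ τ + ∑ η)
        ≡⟨ cong₂ _+_ (cong₂ _+_ (sym (zagreb-squares K))
             (trans (sym (*-distribˡ-sum 2 (λ u → d⁺ K u + d⁻ K u)))
                    (cong (2 *_) (trans (∑-distrib-+ (d⁺ K) (d⁻ K)) (cong (k +_) (∑d⁻ K))))))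
             (cong₂ _+_ ∑τ ∑η) ⟩
      zagreb K + 2 * (k + k) + (m + m) ∎

-- Type (i) in terms of a split: `t j₀` is the centre `w`, and the matching arc `j₁` is the triangle
-- edge `ab`, since `w` reaches its tail and, like every vertex that is not a tail, its head. Any
-- other matching arc `t j → h j` is a path with `x = h j` and `y = t j`. The partner `h j₀` and the
-- unmatched vertices are the pendants.
Star : {A : Digraph n} → Split A m → Set
Star {A = A} S = ∃₂ λ j₀ j₁ → j₁ ≢ j₀ × A (t j₀) (t j₁) ≡ true × (∀ v → (∀ j → t j ≢ v) → A (t j₀) v ≡ true)
  where open Split S

-- The star case

module _ {A : Digraph n} (S : Split A m) (size : arcs A ≡ n) (loopless : ∀ u → A u u ≢ true) where
  open Split S

  -- The n ∸ m heads of K lie among the m matched heads and the n ∸ 2m unmatched vertices,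
  -- of which one (w, or the partner of w) is missed: so some arc of K enters a matched tail,
  -- and since each such arc is wasteful there is exactly one.
  out-star : (w : Fin n) → (∀ {x y} → K x y ≡ true → x ≡ w) → 2 ≤ arcs K → ∑ (waste S) ≤ 1 → Star S
  out-star w from-w k≥2 Z≤1 = centre (kind w)
    where
    open ≤-Reasoning
    2≰1 : ¬ 2 ≤ 1
    2≰1 (s≤s ())

    i g iτ ig : Fin n → ℕ
    i = d⁻ K
    g v = η v + υ v
    iτ v = i v * τ v
    ig v = i v * g v

    i-w : ∀ v → i v ≡ ⟦ K w v ⟧
    i-w v = trans (sum-cong-≗ only) (∑-δ w (λ u → ⟦ K u v ⟧))
      where
      only : ∀ u → ⟦ K u v ⟧ ≡ δ w u * ⟦ K u v ⟧
      only u with w ≟ u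
      ... | yes _ = sym (+-identityʳ _)
      ... | no w≢u with K u v in eq
      ... | true = contradiction (sym (from-w eq)) w≢u
      ... | false = refl

    i≤1 : ∀ v → i v ≤ 1
    i≤1 v = ≤-trans (≤-reflexive (i-w v)) (⟦⟧≤1 (K w v))

    i≡1⇒A : ∀ {v} → i v ≡ 1 → A w v ≡ true
    i≡1⇒A {v} p = K⇒A (⟦⟧≥1 (≤-reflexive (trans (sym p) (i-w v))))

    ¬K⇒i≡0 : ∀ {v} → K w v ≢ true → i v ≡ 0
    ¬K⇒i≡0 {v} p with K w v in eq
    ... | true = contradiction refl p
    ... | false = trans (i-w v) (cong ⟦_⟧ eq)

    out-w : d⁺ K w ≡ arcs K
    out-w = sym (trans (sym (∑d⁻ K)) (sum-cong-≗ i-w))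

    i-w≡0 : i w ≡ 0
    i-w≡0 = ¬K⇒i≡0 (λ e → loopless w (K⇒A e))

    ∑g : ∑ g ≡ arcs K
    ∑g = +-cancelʳ-≡ m (∑ g) (arcs K) (begin-equality
      ∑ g + m               ≡⟨ cong (_+ m) (∑-distrib-+ η υ) ⟩
      ∑ η + ∑ υ + m         ≡⟨ cong (λ s → s + ∑ υ + m) ∑η ⟩
      m + ∑ υ + m           ≡⟨ swap m (∑ υ) ⟩
      ∑ υ + (m + m)         ≡⟨ ∑υ ⟩
      n                     ≡⟨ trans (sym size) (arcs-split S) ⟩
      arcs K + m            ∎)
      where
      swap : ∀ a b → a + b + a ≡ b + (a + a)
      swap = solve-∀

    ∑ig+∑iτ : ∑ ig + ∑ iτ ≡ ∑ g
    ∑ig+∑iτ = begin-equality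
      ∑ ig + ∑ iτ                        ≡⟨ ∑-distrib-+ ig iτ ⟨
      ∑ (λ v → ig v + iτ v)              ≡⟨ sum-cong-≗ (λ v → trans (dist (i v) (τ v) (η v) (υ v)) (trans (cong (i v *_) (τηυ v)) (*-identityʳ _))) ⟩
      ∑ i                                ≡⟨ ∑d⁻ K ⟩
      arcs K                             ≡⟨ ∑g ⟨
      ∑ g                                ∎
      where
      dist : ∀ i a b c → i * (b + c) + i * a ≡ i * (a + b + c)
      dist = solve-∀

    iτ≤waste : ∀ v → iτ v ≤ waste S v
    iτ≤waste v = ≤-trans (m≤n+m (iτ v) (d⁺ K v * η v)) (m≤m+n _ (υ v * (d⁺ K v + d⁻ K v ∸ 1)))

    -- `g` is the indicator of the vertices that are not matched tails, and there are `arcs K` of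
    -- them. If `s` is one of them and no arc of `K` enters it, then `ig` plus the unit mass at `s`
    -- still lies below `g`. Hence some arc of `K` enters a matched tail, and as the waste allows
    -- only one, equality holds at every vertex.
    module _ (s : Fin n) (is≡0 : i s ≡ 0) (gs≡1 : g s ≡ 1) where

      f : Fin n → ℕ
      f v = ig v + δ s v

      f≤g : ∀ v → f v ≤ g v
      f≤g v with s ≟ v
      ... | yes refl = ≤-reflexive (trans (cong (λ a → a * g s + 1) is≡0) (sym gs≡1))
      ... | no _ = ≤-trans (≤-reflexive (+-identityʳ _)) (≤-trans (*-monoˡ-≤ (g v) (i≤1 v)) (≤-reflexive (*-identityˡ (g v))))

      ∑f : ∑ f ≡ ∑ ig + 1
      ∑f = trans (∑-distrib-+ ig (δ s)) (cong (∑ ig +_) (∑-δ₁ s))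

      ∑iτ≥1 : 1 ≤ ∑ iτ
      ∑iτ≥1 = +-cancelˡ-≤ (∑ ig) _ _ (begin
        ∑ ig + 1      ≡⟨ ∑f ⟨
        ∑ f           ≤⟨ ∑-mono f≤g ⟩
        ∑ g           ≡⟨ ∑ig+∑iτ ⟨
        ∑ ig + ∑ iτ   ∎)

      f≡g : ∀ v → f v ≡ g v
      f≡g = ∑-tight f≤g (begin
        ∑ g           ≡⟨ ∑ig+∑iτ ⟨
        ∑ ig + ∑ iτ   ≤⟨ +-monoʳ-≤ (∑ ig) (≤-trans (∑-mono iτ≤waste) Z≤1) ⟩
        ∑ ig + 1      ≡⟨ ∑f ⟨
        ∑ f           ∎)

      saturated : ∀ {v} → s ≢ v → g v ≡ 1 → A w v ≡ true
      saturated {v} s≢v gv≡1 = i≡1⇒A (begin-equality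
        i v              ≡⟨ trans (+-identityʳ (i v * 1)) (*-identityʳ (i v)) ⟨
        i v * 1 + 0      ≡⟨ cong₂ _+_ (cong (i v *_) (sym gv≡1)) (sym (δ-≢ s≢v)) ⟩
        f v              ≡⟨ trans (f≡g v) gv≡1 ⟩
        1                ∎)

    centre : Kind w → Star S
    centre (head j refl) = contradiction (begin
      2                ≤⟨ k≥2 ⟩
      arcs K           ≡⟨ out-w ⟨
      d⁺ K w           ≡⟨ waste-head S j ⟨
      waste S w        ≤⟨ ≤∑ (waste S) w ⟩
      ∑ (waste S)      ≤⟨ Z≤1 ⟩
      1                ∎) 2≰1
    -- The missed vertex is `w` itself. Its surplus degree, at least `arcs K ∸ 1 ≥ 1`, is wasted in
    -- addition to the arc into a tail, for a total of at least 2.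
    centre (free p q) = contradiction (begin
      2                           ≤⟨ +-monoˡ-≤ 1 (∑iτ≥1 w i-w≡0 (cong₂ _+_ (η-other q) (υ-free p q))) ⟩
      ∑ iτ + 1                    ≡⟨ cong (∑ iτ +_) (∑-δ₁ w) ⟨
      ∑ iτ + ∑ (δ w)              ≡⟨ ∑-distrib-+ iτ (δ w) ⟨
      ∑ (λ v → iτ v + δ w v)      ≤⟨ ∑-mono le ⟩
      ∑ (waste S)                 ≤⟨ Z≤1 ⟩
      1                           ∎) 2≰1
      where
      le : ∀ v → iτ v + δ w v ≤ waste S v
      le v with w ≟ v
      ... | no _ = ≤-trans (≤-reflexive (+-identityʳ _)) (iτ≤waste v)
      ... | yes refl = begin
        i w * τ w + 1              ≡⟨ cong (λ s → s * τ w + 1) i-w≡0 ⟩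
        1                          ≤⟨ ∸-monoˡ-≤ 1 k≥2 ⟩
        arcs K ∸ 1                 ≡⟨ cong (_∸ 1) out-w ⟨
        d⁺ K w ∸ 1                 ≤⟨ ∸-monoˡ-≤ 1 (m≤m+n (d⁺ K w) (i w)) ⟩
        d⁺ K w + i w ∸ 1           ≡⟨ waste-free S p q ⟨
        waste S w                  ∎
    -- The missed vertex is the partner `h j₀`: the arc from `w` to it is a matching arc and hence
    -- not in `K`.
    centre (tail j₀ refl) with ∑-pos iτ (∑iτ≥1 (h j₀) (¬K⇒i≡0 (K-matched j₀)) (cong₂ _+_ (η-head j₀) (υ-head j₀)))
    ... | v , p with kind v
    ... | head j refl = contradiction (≤-trans p (≤-reflexive (trans (cong (i v *_) (τ-head j)) (*-zeroʳ (i v))))) (λ ())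
    ... | free q _ = contradiction (≤-trans p (≤-reflexive (trans (cong (i v *_) (τ-other q)) (*-zeroʳ (i v))))) (λ ())
    ... | tail j₁ refl = j₀ , j₁ , (λ { refl → contradiction (trans (sym i-v≡1) i-w≡0) (λ ()) }) , i≡1⇒A i-v≡1 , rest
      where
      i-v≡1 : i (t j₁) ≡ 1
      i-v≡1 = ≤-antisym (i≤1 v) (≤-trans p (≤-reflexive (trans (cong (i v *_) (τ-tail j₁)) (*-identityʳ (i v)))))
      rest : ∀ v → (∀ j → t j ≢ v) → A w v ≡ true
      rest v p with kind v
      ... | tail j q = contradiction q (p j)
      ... | free p q = saturated (h j₀) (¬K⇒i≡0 (K-matched j₀)) (cong₂ _+_ (η-head j₀) (υ-head j₀))
                         (q j₀) (cong₂ _+_ (η-other q) (υ-free p q))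
      ... | head j refl with j ≟ j₀
      ... | yes refl = matched j₀
      ... | no j≢j₀ = saturated (h j₀) (¬K⇒i≡0 (K-matched j₀)) (cong₂ _+_ (η-head j₀) (υ-head j₀))
                         (λ e → j≢j₀ (sym (h-inj e))) (cong₂ _+_ (η-head j) (υ-head j))

-- The orientations of U_{n,m}

∑-at : ∀ {n c} (f : ℕ → ℕ) → c < n → ∑ {n} (λ i → ⟦ c ≡ᵇ toℕ i ⟧ * f (toℕ i)) ≡ f c
∑-at {suc n} {zero} f _ = trans (cong₂ _+_ (+-identityʳ (f 0)) (sum-replicate-zero n)) (+-identityʳ (f 0))
∑-at {suc n} {suc c} f (s≤s c<n) = ∑-at (f ∘ suc) c<n

∑-at₁ : ∀ {n c} → c < n → ∑ {n} (λ i → ⟦ toℕ i ≡ᵇ c ⟧) ≡ 1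
∑-at₁ {suc n} {zero} _ = cong suc (sum-replicate-zero n)
∑-at₁ {suc n} {suc c} (s≤s c<n) = ∑-at₁ c<n

-- This is the order of the labels from 3 on: one pair `x`, `y` for each of `t` attached paths, then
-- `s` pendants.
∑-pairs : ∀ t s (f : ℕ → ℕ) → ∑ {t * 2 + s} (f ∘ toℕ) ≡
          ∑ {t} (λ l → f (toℕ l * 2) + f (1 + toℕ l * 2)) + ∑ {s} (λ r → f (t * 2 + toℕ r))
∑-pairs zero s f = refl
∑-pairs (suc t) s f = trans (cong (λ x → f 0 + (f 1 + x)) (∑-pairs t s (λ x → f (2 + x))))
  (reassoc (f 0) (f 1) (∑ {t} (λ l → f (2 + toℕ l * 2) + f (3 + toℕ l * 2))) (∑ {s} (λ r → f (2 + (t * 2 + toℕ r)))))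
  where
  reassoc : ∀ a b c d → a + (b + (c + d)) ≡ a + b + c + d
  reassoc = solve-∀

≤ᵇ-true : ∀ {a b} → a ≤ b → (a ≤ᵇ b) ≡ true
≤ᵇ-true {a} {b} p with a ≤ᵇ b | ≤⇒≤ᵇ p
... | true | _ = refl

≤ᵇ-false : ∀ {a b} → b < a → (a ≤ᵇ b) ≡ false
≤ᵇ-false {a} {b} p with a ≤ᵇ b in eq
... | true = contradiction (≤ᵇ⇒≤ a b (subst T (sym eq) tt)) (<⇒≱ p)
... | false = refl

≡true⇒≤ : ∀ a b → (a ≤ᵇ b) ≡ true → a ≤ b
≡true⇒≤ a b p = ≤ᵇ⇒≤ a b (subst T (sym p) tt)

≡true⇒≡ : ∀ a b → (a ≡ᵇ b) ≡ true → a ≡ b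
≡true⇒≡ a b p = ≡ᵇ⇒≡ a b (subst T (sym p) tt)

odd-double : ∀ l → odd (l * 2) ≡ false
odd-double zero = refl
odd-double (suc l) = cong (not ∘ not) (odd-double l)

-- In Labels, Model and Relabel the size is n = 3 + 2t + s, with t attached paths and s ≥ 1 pendants.
module Labels (t : ℕ) where

  m₀ : ℕ
  m₀ = 2 + t

  double : 2 * m₀ ≡ 4 + t * 2
  double = *-comm 2 m₀

  isX-odd : ∀ {l} → l < t → isX m₀ (3 + l * 2) ≡ true
  isX-odd {l} l<t = cong₂ _∧_ (≤ᵇ-true {3 + l * 2} (≤-trans (s≤s (*-monoˡ-≤ 2 l<t)) (≤-reflexive (cong (_∸ 3) (sym double)))))
                             (cong (not ∘ not ∘ not) (odd-double l))

  isX-even : ∀ l → isX m₀ (4 + l * 2) ≡ false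
  isX-even l = trans (cong ((4 + l * 2 ≤ᵇ 2 * m₀ ∸ 3) ∧_) (odd-double (2 + l))) (∧-zeroʳ _)

  isX-large : ∀ r → isX m₀ (3 + (t * 2 + r)) ≡ false
  isX-large r = cong (_∧ odd (3 + (t * 2 + r)))
    (≤ᵇ-false {3 + (t * 2 + r)} (≤-trans (≤-reflexive (cong (λ x → suc (x ∸ 3)) double)) (s≤s (s≤s (≤-trans (m≤m+n (t * 2) r) (n≤1+n _))))))

  isY-odd : ∀ l → isY m₀ (3 + l * 2) ≡ false
  isY-odd l = trans (cong (λ b → (4 ≤ᵇ 3 + l * 2) ∧ (3 + l * 2 ≤ᵇ 2 * m₀ ∸ 2) ∧ not (not (not (not b)))) (odd-double l))
                   (trans (cong ((4 ≤ᵇ 3 + l * 2) ∧_) (∧-zeroʳ _)) (∧-zeroʳ _))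

  isY-even : ∀ {l} → l < t → isY m₀ (4 + l * 2) ≡ true
  isY-even {l} l<t = cong₂ _∧_ (≤ᵇ-true {4 + l * 2} (≤-trans (s≤s (s≤s (*-monoˡ-≤ 2 l<t))) (≤-reflexive (cong (_∸ 2) (sym double)))))
                              (cong not (odd-double (2 + l)))

  isY-large : ∀ r → isY m₀ (3 + (t * 2 + r)) ≡ false
  isY-large r = trans (cong ((4 ≤ᵇ 3 + (t * 2 + r)) ∧_) (cong (_∧ not (odd (3 + (t * 2 + r)))) beyond)) (∧-zeroʳ _)
    where
    beyond : (3 + (t * 2 + r) ≤ᵇ 2 * m₀ ∸ 2) ≡ false
    beyond = ≤ᵇ-false {3 + (t * 2 + r)} (≤-trans (≤-reflexive (cong (λ x → suc (x ∸ 2)) double)) (s≤s (s≤s (s≤s (m≤m+n (t * 2) r)))))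

  isX⇒< : ∀ {j} → isX m₀ j ≡ true → j < 2 + t * 2
  isX⇒< {j} p = s≤s (≤-trans (≡true⇒≤ j _ (proj₁ (∧-true (j ≤ᵇ 2 * m₀ ∸ 3) (proj₂ (∧-true (3 ≤ᵇ j) p))))) (≤-reflexive (cong (_∸ 3) double)))
    where
    ∧-true : ∀ a {b} → a ∧ b ≡ true → a ≡ true × b ≡ true
    ∧-true true p = refl , p

isW : ℕ → ℕ → Bool
isW m j = not (j ≡ᵇ 0) ∧ not (isY m j)

-- The disjuncts of `Utype1` exclude one another, so their indicators add. Each summand is a
-- selector for `i` times a function of `j`, which lets row and column sums collapse to single terms
-- or simple counts.
Utype1-entry : ∀ m b i j → ⟦ Utype1 m b i j ⟧ ≡
  ⟦ i ≡ᵇ 0 ⟧ * ⟦ isW m j ⟧ + ⟦ i ≡ᵇ suc j ⟧ * ⟦ isX m j ⟧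
  + ⟦ i ≡ᵇ 1 ⟧ * (⟦ 2 ≡ᵇ j ⟧ * ⟦ b ⟧) + ⟦ i ≡ᵇ 2 ⟧ * (⟦ 1 ≡ᵇ j ⟧ * ⟦ not b ⟧)
Utype1-entry m true = entry
  where
  entry : ∀ i j → ⟦ Utype1 m true i j ⟧ ≡ ⟦ i ≡ᵇ 0 ⟧ * ⟦ isW m j ⟧ + ⟦ i ≡ᵇ suc j ⟧ * ⟦ isX m j ⟧
    + ⟦ i ≡ᵇ 1 ⟧ * (⟦ 2 ≡ᵇ j ⟧ * 1) + ⟦ i ≡ᵇ 2 ⟧ * (⟦ 1 ≡ᵇ j ⟧ * 0)
  entry 0 0 = refl
  entry 0 1 = refl
  entry 0 2 = refl
  entry 0 (suc (suc (suc j))) with isX m (3 + j) | isY m (3 + j)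
  ... | true | true = refl
  ... | true | false = refl
  ... | false | true = refl
  ... | false | false = refl
  entry 1 0 = refl
  entry 1 1 = refl
  entry 1 2 = refl
  entry 1 (suc (suc (suc j))) with isX m (3 + j)
  ... | true = refl
  ... | false = refl
  entry 2 0 = refl
  entry 2 1 = refl
  entry 2 2 = refl
  entry 2 (suc (suc (suc j))) with isX m (3 + j)
  ... | true = refl
  ... | false = refl
  entry (suc (suc (suc i))) j with isX m j | 2 + i ≡ᵇ j
  ... | true | true = refl
  ... | true | false = refl
  ... | false | true = refl
  ... | false | false = refl

Utype1-entry m false = entry
  where
  entry : ∀ i j → ⟦ Utype1 m false i j ⟧ ≡ ⟦ i ≡ᵇ 0 ⟧ * ⟦ isW m j ⟧ + ⟦ i ≡ᵇ suc j ⟧ * ⟦ isX m j ⟧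
    + ⟦ i ≡ᵇ 1 ⟧ * (⟦ 2 ≡ᵇ j ⟧ * 0) + ⟦ i ≡ᵇ 2 ⟧ * (⟦ 1 ≡ᵇ j ⟧ * 1)
  entry 0 0 = refl
  entry 0 1 = refl
  entry 0 2 = refl
  entry 0 (suc (suc (suc j))) with isX m (3 + j) | isY m (3 + j)
  ... | true | true = refl
  ... | true | false = refl
  ... | false | true = refl
  ... | false | false = refl
  entry 1 0 = refl
  entry 1 1 = refl
  entry 1 2 = refl
  entry 1 (suc (suc (suc j))) with isX m (3 + j)
  ... | true = refl
  ... | false = refl
  entry 2 0 = refl
  entry 2 1 = refl
  entry 2 2 = refl
  entry 2 (suc (suc (suc j))) with isX m (3 + j)
  ... | true = refl
  ... | false = refl
  entry (suc (suc (suc i))) j with isX m j | 2 + i ≡ᵇ j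
  ... | true | true = refl
  ... | true | false = refl
  ... | false | true = refl
  ... | false | false = refl

module Model (t s : ℕ) (b : Bool) where
  open Labels t

  n₀ : ℕ
  n₀ = 3 + (t * 2 + s)

  U : Digraph n₀
  U = onFin n₀ (Utype1 m₀ b)

  1<n₀ : 1 < n₀
  1<n₀ = s≤s (s≤s z≤n)

  2<n₀ : 2 < n₀
  2<n₀ = s≤s (s≤s (s≤s z≤n))

  ∑-+₄ : (f g h k : Fin n₀ → ℕ) → ∑ (λ i → f i + g i + h i + k i) ≡ ∑ f + ∑ g + ∑ h + ∑ k
  ∑-+₄ f g h k = trans (∑-distrib-+ (λ i → f i + g i + h i) k) (cong (_+ ∑ k)
    (trans (∑-distrib-+ (λ i → f i + g i) h) (cong (_+ ∑ h) (∑-distrib-+ f g))))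

  inn : ℕ → ℕ
  inn j = ⟦ isW m₀ j ⟧ + ⟦ isX m₀ j ⟧ + ⟦ 2 ≡ᵇ j ⟧ * ⟦ b ⟧ + ⟦ 1 ≡ᵇ j ⟧ * ⟦ not b ⟧

  d⁻-U : ∀ v → d⁻ U v ≡ inn (toℕ v)
  d⁻-U v = trans (sum-cong-≗ {n₀} (λ u → Utype1-entry m₀ b (toℕ u) j)) (trans (∑-+₄
      (λ u → ⟦ toℕ u ≡ᵇ 0 ⟧ * ⟦ isW m₀ j ⟧) (λ u → ⟦ toℕ u ≡ᵇ suc j ⟧ * ⟦ isX m₀ j ⟧)
      (λ u → ⟦ toℕ u ≡ᵇ 1 ⟧ * (⟦ 2 ≡ᵇ j ⟧ * ⟦ b ⟧)) (λ u → ⟦ toℕ u ≡ᵇ 2 ⟧ * (⟦ 1 ≡ᵇ j ⟧ * ⟦ not b ⟧)))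
    (cong₂ _+_ (cong₂ _+_ (cong₂ _+_ (scaled 0 (s≤s z≤n) ⟦ isW m₀ j ⟧) below) (scaled 1 1<n₀ (⟦ 2 ≡ᵇ j ⟧ * ⟦ b ⟧))) (scaled 2 2<n₀ (⟦ 1 ≡ᵇ j ⟧ * ⟦ not b ⟧))))
    where
    j = toℕ v
    scaled : ∀ c → c < n₀ → ∀ x → ∑ {n₀} (λ u → ⟦ toℕ u ≡ᵇ c ⟧ * x) ≡ x
    scaled c c<n x = trans (sym (*-distribʳ-sum x (λ (u : Fin n₀) → ⟦ toℕ u ≡ᵇ c ⟧))) (trans (cong (_* x) (∑-at₁ c<n)) (+-identityʳ x))
    below : ∑ {n₀} (λ u → ⟦ toℕ u ≡ᵇ suc j ⟧ * ⟦ isX m₀ j ⟧) ≡ ⟦ isX m₀ j ⟧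
    below with isX m₀ j in eq
    ... | true = scaled (suc j) (≤-trans (s≤s (isX⇒< eq)) (s≤s (s≤s (s≤s (m≤m+n (t * 2) s))))) 1
    ... | false = ∑-zero {n₀} (λ u → *-zeroʳ ⟦ toℕ u ≡ᵇ suc j ⟧)

  out : ℕ → ℕ
  -- The second summand is the arc from `y = x + 1` to `x`. At `i = 0` the truncated predecessor is
  -- 0, which is not the label of an `x`.
  out i = ⟦ i ≡ᵇ 0 ⟧ * (2 + t + s) + ⟦ isX m₀ (i ∸ 1) ⟧ + ⟦ i ≡ᵇ 1 ⟧ * ⟦ b ⟧ + ⟦ i ≡ᵇ 2 ⟧ * ⟦ not b ⟧

  ∑isW : ∑ {n₀} (λ v → ⟦ isW m₀ (toℕ v) ⟧) ≡ 2 + t + s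
  ∑isW = cong (λ x → suc (suc x)) (trans (∑-pairs t s (λ j → ⟦ isW m₀ (3 + j) ⟧)) (cong₂ _+_
    (trans (sum-cong-≗ {t} (λ l → cong₂ (λ x y → ⟦ not x ⟧ + ⟦ not y ⟧) (isY-odd (toℕ l)) (isY-even (toℕ<n l)))) (trans (∑-const t 1) (*-identityʳ t)))
    (trans (sum-cong-≗ {s} (λ r → cong (λ x → ⟦ not x ⟧) (isY-large (toℕ r)))) (trans (∑-const s 1) (*-identityʳ s)))))

  d⁺-U : ∀ u → d⁺ U u ≡ out (toℕ u)
  d⁺-U u = trans (sum-cong-≗ {n₀} (λ v → Utype1-entry m₀ b i (toℕ v))) (trans (∑-+₄
      (λ v → ⟦ i ≡ᵇ 0 ⟧ * ⟦ isW m₀ (toℕ v) ⟧) (λ v → ⟦ i ≡ᵇ suc (toℕ v) ⟧ * ⟦ isX m₀ (toℕ v) ⟧)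
      (λ v → ⟦ i ≡ᵇ 1 ⟧ * (⟦ 2 ≡ᵇ toℕ v ⟧ * ⟦ b ⟧)) (λ v → ⟦ i ≡ᵇ 2 ⟧ * (⟦ 1 ≡ᵇ toℕ v ⟧ * ⟦ not b ⟧)))
    (cong₂ _+_ (cong₂ _+_ (cong₂ _+_
      (trans (sym (*-distribˡ-sum ⟦ i ≡ᵇ 0 ⟧ (λ (v : Fin n₀) → ⟦ isW m₀ (toℕ v) ⟧))) (cong (⟦ i ≡ᵇ 0 ⟧ *_) ∑isW))
      (below i (toℕ<n u)))
      (scaled ⟦ i ≡ᵇ 1 ⟧ 2 ⟦ b ⟧ 2<n₀)) (scaled ⟦ i ≡ᵇ 2 ⟧ 1 ⟦ not b ⟧ 1<n₀)))
    where
    i = toℕ u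
    below : ∀ i → i < n₀ → ∑ {n₀} (λ v → ⟦ i ≡ᵇ suc (toℕ v) ⟧ * ⟦ isX m₀ (toℕ v) ⟧) ≡ ⟦ isX m₀ (i ∸ 1) ⟧
    below zero _ = ∑-zero {n₀} (λ v → refl)
    below (suc i) i<n = ∑-at (λ j → ⟦ isX m₀ j ⟧) (≤-trans (n≤1+n _) i<n)
    scaled : ∀ a c x → c < n₀ → ∑ {n₀} (λ v → a * (⟦ c ≡ᵇ toℕ v ⟧ * x)) ≡ a * x
    scaled a c x c<n = trans (sym (*-distribˡ-sum a (λ (v : Fin n₀) → ⟦ c ≡ᵇ toℕ v ⟧ * x))) (cong (a *_) (∑-at (λ _ → x) c<n))

  inn-odd : ∀ {l} → l < t → inn (3 + l * 2) ≡ 2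
  inn-odd {l} l<t rewrite isY-odd l | isX-odd l<t = refl

  inn-even : ∀ {l} → l < t → inn (4 + l * 2) ≡ 0
  inn-even {l} l<t rewrite isY-even l<t | isX-even l = refl

  inn-large : ∀ r → inn (3 + (t * 2 + r)) ≡ 1
  inn-large r rewrite isY-large r | isX-large r = refl

  out-odd : ∀ l → out (3 + l * 2) ≡ 0
  out-odd zero = refl
  out-odd (suc l) rewrite isX-even l = refl

  out-even : ∀ {l} → l < t → out (4 + l * 2) ≡ 1
  out-even l<t rewrite isX-odd l<t = refl

  out-large : ∀ r → out (3 + (t * 2 + r)) ≡ 0
  out-large (suc r) rewrite +-suc (t * 2) r | isX-large r = refl
  out-large zero rewrite +-identityʳ (t * 2) = out-odd t

  blocks : ∀ (f : ℕ → ℕ) {p q r} → (∀ {l} → l < t → f (3 + l * 2) ≡ p) → (∀ {l} → l < t → f (4 + l * 2) ≡ q) →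
           (∀ x → f (3 + (t * 2 + x)) ≡ r) → ∑ {n₀} (f ∘ toℕ) ≡ f 0 + (f 1 + (f 2 + (t * (p + q) + s * r)))
  blocks f {p} {q} {r} fp fq fr = cong (λ x → f 0 + (f 1 + (f 2 + x))) (trans (∑-pairs t s (λ j → f (3 + j))) (cong₂ _+_
    (trans (sum-cong-≗ {t} (λ l → cong₂ _+_ (fp (toℕ<n l)) (fq (toℕ<n l)))) (∑-const t (p + q)))
    (trans (sum-cong-≗ {s} (λ x → fr (toℕ x))) (∑-const s r))))

  arcs-U : arcs U ≡ n₀
  arcs-U = trans (sym (∑d⁻ U)) (trans (sum-cong-≗ d⁻-U) (trans (blocks inn inn-odd inn-even inn-large)
    (trans (triangle b (t * 2 + s * 1)) (cong (λ x → 3 + (t * 2 + x)) (*-identityʳ s)))))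
    where
    triangle : ∀ b x → (1 + 0 + 0 * ⟦ b ⟧ + 1 * ⟦ not b ⟧) + ((1 + 0 + 1 * ⟦ b ⟧ + 0 * ⟦ not b ⟧) + x) ≡ 3 + x
    triangle true x = refl
    triangle false x = refl

  -- Sum of squares by blocks: `(2 + t + s)²` at the centre, 6 at the other two triangle vertices,
  -- `4 + 1` on each attached path and 1 at each pendant. So the deficit is exactly 2.
  zagreb-U : zagreb U + 2 ≡ excess (1 + t + s) m₀
  zagreb-U = trans (cong (_+ 2) (trans (zagreb-squares U)
      (trans (sum-cong-≗ (λ u → cong₂ _+_ (cong₂ _*_ (d⁺-U u) (d⁺-U u)) (cong₂ _*_ (d⁻-U u) (d⁻-U u))))
      (trans (blocks (λ j → out j * out j + inn j * inn j)
                (λ {l} l<t → cong₂ _+_ (cong₂ _*_ (out-odd l) (out-odd l)) (cong₂ _*_ (inn-odd l<t) (inn-odd l<t)))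
                (λ l<t → cong₂ _+_ (cong₂ _*_ (out-even l<t) (out-even l<t)) (cong₂ _*_ (inn-even l<t) (inn-even l<t)))
                (λ x → cong₂ _+_ (cong₂ _*_ (out-large x) (out-large x)) (cong₂ _*_ (inn-large x) (inn-large x))))
             (cong (λ x → (c * c + 0) + x) (triangle b (t * 5 + s * 1)))))))
    (total t s)
    where
    c = 1 * (2 + t + s) + 0 + 0 + 0
    triangle : ∀ b x → let o₁ = 0 + 0 + 1 * ⟦ b ⟧ + 0 * ⟦ not b ⟧
                           i₁ = 1 + 0 + 0 * ⟦ b ⟧ + 1 * ⟦ not b ⟧
                           o₂ = 0 + 0 + 0 * ⟦ b ⟧ + 1 * ⟦ not b ⟧
                           i₂ = 1 + 0 + 1 * ⟦ b ⟧ + 0 * ⟦ not b ⟧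
                       in (o₁ * o₁ + i₁ * i₁) + ((o₂ * o₂ + i₂ * i₂) + x) ≡ 6 + x
    triangle true x = refl
    triangle false x = refl
    total : ∀ t s → let c = 1 * (2 + t + s) + 0 + 0 + 0 in
      (c * c + 0) + (6 + (t * 5 + s * 1)) + 2 ≡ (1 + t + s) * (1 + t + s) + 3 * (1 + t + s) + 4 * (2 + t)
    total = solve-∀

permute-injective : (π : Permutation′ n) {i j : Fin n} → π ⟨$⟩ʳ i ≡ π ⟨$⟩ʳ j → i ≡ j
permute-injective π e = trans (sym (inverseˡ π)) (trans (cong (π ⟨$⟩ˡ_) e) (inverseˡ π))

odd⇒ : ∀ j → odd j ≡ true → ∃ λ l → j ≡ 1 + l * 2
odd⇒ 1 _ = 0 , refl
odd⇒ (suc (suc j)) p with odd j in eq | odd⇒ j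
... | true | rec with rec refl
... | l , q = suc l , cong (2 +_) q

Utype1-cases : ∀ m i j → Utype1 m false i j ≡ true →
  (i ≡ 0 × j ≢ 0 × isY m j ≡ false) ⊎ (isX m j ≡ true × i ≡ suc j) ⊎ (i ≡ 2 × j ≡ 1)
Utype1-cases m i j p = result
  where
  or : ∀ a {b} → a ∨ b ≡ true → a ≡ true ⊎ b ≡ true
  or true _ = inj₁ refl
  or false p = inj₂ p
  and : ∀ a {b} → a ∧ b ≡ true → a ≡ true × b ≡ true
  and true p = refl , p
  not-true : ∀ {a} → not a ≡ true → a ≡ false
  not-true {false} _ = refl
  result : _
  result with or ((i ≡ᵇ 0) ∧ not (j ≡ᵇ 0) ∧ not (isY m j)) p
  ... | inj₁ q with and (i ≡ᵇ 0) q
  ... | i0 , q′ with and (not (j ≡ᵇ 0)) q′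
  ... | j≢0 , y = inj₁ (≡true⇒≡ i 0 i0 , (λ { refl → contradiction j≢0 λ () }) , not-true y)
  result | inj₂ q with or (isX m j ∧ (i ≡ᵇ suc j)) q
  ... | inj₁ q′ with and (isX m j) q′
  ... | x , ij = inj₂ (inj₁ (x , ≡true⇒≡ i (suc j) ij))
  result | inj₂ q | inj₂ q′ with and (i ≡ᵇ 2) q′
  ... | i2 , j1 = inj₂ (inj₂ (≡true⇒≡ i 2 i2 , ≡true⇒≡ j 1 j1))

isX⇒odd : ∀ m j → isX m j ≡ true → odd j ≡ true
isX⇒odd m j p with 3 ≤ᵇ j | j ≤ᵇ 2 * m ∸ 3
... | true | true = p

module _ (p s : ℕ) {A : Digraph (3 + (p * 2 + suc s))} (S : Split A (2 + p)) where
  open Split S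
  open Labels p
  open Model p (suc s) false

  -- `ρ` renumbers the matching so that the arc at the centre comes first and the one closing the
  -- triangle second.
  module Relabel {j₀ j₁ : Fin m₀} (A₀₁ : A (t j₀) (t j₁) ≡ true)
    (A₀ : ∀ v → (∀ j → t j ≢ v) → A (t j₀) v ≡ true)
    (ρ : Permutation′ m₀) (ρ0 : ρ ⟨$⟩ʳ zero ≡ j₀) (ρ1 : ρ ⟨$⟩ʳ suc zero ≡ j₁) where

    T′ H′ : Fin m₀ → Fin n₀
    T′ l = t (ρ ⟨$⟩ʳ l)
    H′ l = h (ρ ⟨$⟩ʳ l)

    T′-inj : ∀ i j → T′ i ≡ T′ j → i ≡ j
    T′-inj i j e = permute-injective ρ (t-inj e)

    H′-inj : ∀ i j → H′ i ≡ H′ j → i ≡ j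
    H′-inj i j e = permute-injective ρ (h-inj e)

    -- The centre gets label 0 and the (l + 1)st matching arc the labels 2 + 2l → 1 + 2l, as in Utype1;
    -- the partner of the centre is an ordinary pendant.
    pick : Fin (suc p) × Fin 2 → Fin n₀
    pick (l , zero) = H′ (suc l)
    pick (l , suc zero) = T′ (suc l)

    pick-inj : ∀ {x y} → pick x ≡ pick y → x ≡ y
    pick-inj {k , zero} {l , zero} e = cong (_, zero) (suc-injective (H′-inj (suc k) (suc l) e))
    pick-inj {_ , zero} {_ , suc zero} e = contradiction (sym e) (t≢h _ _)
    pick-inj {_ , suc zero} {_ , zero} e = contradiction e (t≢h _ _)
    pick-inj {k , suc zero} {l , suc zero} e = cong (_, suc zero) (suc-injective (T′-inj (suc k) (suc l) e))

    pick≢ : ∀ x → T′ zero ≢ pick x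
    pick≢ (_ , zero) e = t≢h _ _ e
    pick≢ (l , suc zero) e with T′-inj zero (suc l) e
    ... | ()

    -- Only the `3 + 2p` vertices with a prescribed role are labelled. `completion` gives the other
    -- labels to the partner of the centre and the unmatched vertices, which are interchangeable
    -- pendants.
    ι : Fin (suc (suc p * 2)) → Fin n₀
    ι zero = T′ zero
    ι (suc q) = pick (remQuot 2 q)

    ι-inj : ∀ {i j} → ι i ≡ ι j → i ≡ j
    ι-inj {zero} {zero} _ = refl
    ι-inj {zero} {suc j} e = contradiction e (pick≢ (remQuot 2 j))
    ι-inj {suc i} {zero} e = contradiction (sym e) (pick≢ (remQuot 2 i))
    ι-inj {suc i} {suc j} e = cong suc (trans (sym (combine-remQuot {suc p} 2 i))
      (trans (cong (λ (x : Fin (suc p) × Fin 2) → combine (proj₁ x) (proj₂ x)) (pick-inj {remQuot 2 i} {remQuot 2 j} e)) (combine-remQuot {suc p} 2 j)))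

    module _ (π : Permutation′ n₀) (π-ι : ∀ i j → toℕ i ≡ toℕ j → π ⟨$⟩ʳ j ≡ ι i) where

      π-0 : ∀ {j} → toℕ j ≡ 0 → π ⟨$⟩ʳ j ≡ T′ zero
      π-0 {j} e = π-ι zero j (sym e)

      π-pick : ∀ (l : Fin (suc p)) (e : Fin 2) {j} → toℕ j ≡ 1 + (toℕ e + toℕ l * 2) → π ⟨$⟩ʳ j ≡ pick (l , e)
      π-pick l e {j} eq = trans (π-ι (suc (combine l e)) j
          (trans (cong suc (trans (toℕ-combine l e) (trans (+-comm (2 * toℕ l) (toℕ e)) (cong (toℕ e +_) (*-comm 2 (toℕ l)))))) (sym eq)))
        (cong pick (remQuot-combine {suc p} l e))

      -- Three kinds of targets: the tail at label 2, reached by `A₀₁`; a tail at a label `4 + 2l`,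
      -- which is a `y` and so excluded; and a vertex that is not a matched tail, reached by `A₀`.
      from-centre : ∀ {i j} → toℕ i ≡ 0 → toℕ j ≢ 0 → isY m₀ (toℕ j) ≡ false → A (T′ zero) (π ⟨$⟩ʳ j) ≡ true
      from-centre {i} {j} i≡0 j≢0 ¬y with any? (λ l → T′ (suc l) ≟ π ⟨$⟩ʳ j)
      ... | yes (zero , e) = subst (λ v → A (T′ zero) v ≡ true) e
                               (trans (cong₂ (λ x y → A (t x) (t y)) ρ0 ρ1) A₀₁)
      ... | yes (suc l , e) = contradiction (trans (sym ¬y) (trans (cong (isY m₀) label) (isY-even (toℕ<n l)))) (λ ())
        where
        4+2l<n : 4 + toℕ l * 2 < n₀
        4+2l<n = s≤s (s≤s (s≤s (≤-trans (*-monoˡ-≤ 2 (toℕ<n l)) (m≤m+n (p * 2) (suc s)))))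
        label : toℕ j ≡ 4 + toℕ l * 2
        label = trans (cong toℕ (permute-injective π {j} {fromℕ< 4+2l<n}
                  (trans (sym e) (sym (π-pick (suc l) (suc zero) (toℕ-fromℕ< 4+2l<n))))))
                (toℕ-fromℕ< 4+2l<n)
      ... | no ¬T = subst (λ x → A (t x) (π ⟨$⟩ʳ j) ≡ true) (sym ρ0) (A₀ _ (λ i → subst (λ x → t x ≢ π ⟨$⟩ʳ j) (inverseʳ ρ) (unmatched (ρ ⟨$⟩ˡ i))))
        where
        unmatched : ∀ l → T′ l ≢ π ⟨$⟩ʳ j
        unmatched zero e = j≢0 (trans (cong toℕ (permute-injective π (trans (sym e) (sym (π-0 i≡0))))) i≡0)
        unmatched (suc l) e = ¬T (l , e)

      along-matching : ∀ (l : Fin (suc p)) {i j} → toℕ j ≡ 1 + toℕ l * 2 → toℕ i ≡ suc (toℕ j) →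
        A (π ⟨$⟩ʳ i) (π ⟨$⟩ʳ j) ≡ true
      along-matching l {i} {j} ej ei = trans (cong₂ A (π-pick l (suc zero) {i} (trans ei (cong suc ej))) (π-pick l zero {j} ej)) (matched (ρ ⟨$⟩ʳ suc l))

      maps : ∀ i j → U i j ≡ true → A (π ⟨$⟩ʳ i) (π ⟨$⟩ʳ j) ≡ true
      maps i j u with Utype1-cases m₀ (toℕ i) (toℕ j) u
      ... | inj₁ (i≡0 , j≢0 , ¬y) = subst (λ v → A v (π ⟨$⟩ʳ j) ≡ true) (sym (π-0 {i} i≡0)) (from-centre {i} {j} i≡0 j≢0 ¬y)
      ... | inj₂ (inj₂ (i≡2 , j≡1)) = along-matching zero {i} {j} j≡1 (trans i≡2 (cong suc (sym j≡1)))
      ... | inj₂ (inj₁ (x , i≡1+j)) with odd⇒ (toℕ j) (isX⇒odd m₀ (toℕ j) x)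
      ... | l , e = along-matching (fromℕ< l<1+p) {i} {j} (trans e (cong (λ x → 1 + x * 2) (sym (toℕ-fromℕ< l<1+p)))) i≡1+j
        where
        l<1+p : l < suc p
        l<1+p = *-cancelʳ-< 2 l (suc p) (≤-trans (≤-reflexive (sym e)) (≤-trans (n≤1+n _) (isX⇒< x)))

    relabelled : arcs A ≡ n₀ → A ≅ U
    relabelled size = conclude (completion ι ι-inj)
      where
      conclude : (Σ (Permutation′ n₀) λ π → ∀ i j → toℕ i ≡ toℕ j → π ⟨$⟩ʳ j ≡ ι i) → A ≅ U
      conclude (π , π-ι) = ≅-from-arcs A U π (maps π π-ι) (≤-reflexive (trans size (sym arcs-U)))

  -- The triangle edge `ab` is a matching arc and always receives the labels `2 → 1`, so the flag is
  -- `false`; the other flag gives an isomorphic digraph, by exchanging the labels 1 and 2.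
  star⇒≅ : Star S → arcs A ≡ n₀ → A ≅ U
  star⇒≅ (j₀ , j₁ , j₁≢j₀ , A₀₁ , A₀) size = conclude (completion ends ends-inj)
    where
    ends : Fin 2 → Fin m₀
    ends zero = j₀
    ends (suc zero) = j₁
    ends-inj : ∀ {i j} → ends i ≡ ends j → i ≡ j
    ends-inj {zero} {zero} _ = refl
    ends-inj {zero} {suc zero} e = contradiction (sym e) j₁≢j₀
    ends-inj {suc zero} {zero} e = contradiction e j₁≢j₀
    ends-inj {suc zero} {suc zero} _ = refl
    conclude : (Σ (Permutation′ m₀) λ ρ → ∀ i j → toℕ i ≡ toℕ j → ρ ⟨$⟩ʳ j ≡ ends i) → A ≅ U
    conclude (ρ , extends) = Relabel.relabelled A₀₁ A₀ ρ (extends zero zero refl) (extends (suc zero) (suc zero) refl) size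

-- The sporadic orientations

onto : (ι : Fin m → Fin n) → (∀ {i j} → ι i ≡ ι j → i ≡ j) → n ≡ m → ∀ u → ∃ λ i → ι i ≡ u
onto ι inj refl u with completion ι inj
... | π , π-ι = π ⟨$⟩ˡ u , trans (sym (π-ι _ _ refl)) (inverseʳ π)

≅-from-labels : (A : Digraph n) (R : ℕ → ℕ → Bool) (ι : Fin m → Fin n) → (∀ {i j} → ι i ≡ ι j → i ≡ j) → n ≡ m →
  (∀ i j → R (toℕ i) (toℕ j) ≡ true → A (ι i) (ι j) ≡ true) → arcs A ≤ arcs (onFin m R) → A ≅ onFin n R
≅-from-labels {n} A R ι inj refl maps le = conclude (completion ι inj)
  where
  conclude : (Σ (Permutation′ n) λ π → ∀ i j → toℕ i ≡ toℕ j → π ⟨$⟩ʳ j ≡ ι i) → A ≅ onFin n R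
  conclude (π , π-ι) = ≅-from-arcs A (onFin n R) π
    (λ i j r → trans (cong₂ A (π-ι i i refl) (π-ι j j refl)) (maps i j r)) le

module FourCycle {A : Digraph n} (S : Split A m) (size : arcs A ≡ n) (2≤m : 2 ≤ m) (2m≤n : m + m ≤ n)
  (no-waste : ∀ u → waste S u ≡ 0) (clashes≤2 : clashes (Split.K S) ≤ 2) where
  open Split S

  d⁺≥1 : ∀ {u v} → K u v ≡ true → 1 ≤ d⁺ K u
  d⁺≥1 {u} {v} k = ≤-trans (≤-reflexive (sym (cong ⟦_⟧ k))) (≤∑ (λ v → ⟦ K u v ⟧) v)

  d⁻≥1 : ∀ {u v} → K u v ≡ true → 1 ≤ d⁻ K v
  d⁻≥1 {u} {v} k = ≤-trans (≤-reflexive (sym (cong ⟦_⟧ k))) (≤∑ (λ u → ⟦ K u v ⟧) u)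

  no-in-tail : ∀ {u} i → K u (t i) ≢ true
  no-in-tail i k = contradiction (≤-trans (d⁻≥1 k) (≤-reflexive (trans (sym (waste-tail S i)) (no-waste _)))) λ ()

  no-out-head : ∀ {v} i → K (h i) v ≢ true
  no-out-head i k = contradiction (≤-trans (d⁺≥1 k) (≤-reflexive (trans (sym (waste-head S i)) (no-waste _)))) λ ()

  free-deg : ∀ {u} → (∀ i → t i ≢ u) → (∀ i → h i ≢ u) → ¬ 2 ≤ d⁺ K u + d⁻ K u
  free-deg {u} p q 2≤ = contradiction (≤-trans (∸-monoˡ-≤ 1 2≤) (≤-reflexive (trans (sym (waste-free S p q)) (no-waste u)))) λ ()

  -- An arc of `K` into a matched tail, one out of a matched head and a second one at an unmatched
  -- vertex are all wasted, and `no-waste` forbids each of them.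
  source-or-sink : ∀ {x u y} → K x u ≡ true → K u y ≢ true
  source-or-sink {u = u} in-u out-u with kind u
  ... | tail i refl = no-in-tail i in-u
  ... | head i refl = no-out-head i out-u
  ... | free p q = free-deg p q (+-mono-≤ (d⁺≥1 out-u) (d⁻≥1 in-u))

  two-hits : ∀ (f : Fin n → Bool) {a b} → f a ≡ true → f b ≡ true → a ≢ b → 2 ≤ ∑ (λ v → ⟦ f v ⟧)
  two-hits f {a} {b} fa fb a≢b = ≤-trans (≤-reflexive (sym (trans (∑-distrib-+ (δ a) (δ b)) (cong₂ _+_ (∑-δ₁ a) (∑-δ₁ b))))) (∑-mono le)
    where
    le : ∀ v → δ a v + δ b v ≤ ⟦ f v ⟧
    le v with a ≟ v | b ≟ v
    ... | yes refl | yes refl = contradiction refl a≢b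
    ... | yes refl | no _ = ≤-reflexive (sym (cong ⟦_⟧ fa))
    ... | no _ | yes refl = ≤-reflexive (sym (cong ⟦_⟧ fb))
    ... | no _ | no _ = z≤n

  two-out⇒tail : ∀ {u a b} → K u a ≡ true → K u b ≡ true → a ≢ b → ∃ λ i → t i ≡ u
  two-out⇒tail {u} ka kb a≢b with kind u
  ... | tail i p = i , p
  ... | head i refl = contradiction ka (no-out-head i)
  ... | free p q = contradiction (≤-trans (two-hits (K u) ka kb a≢b) (m≤m+n _ _)) (free-deg p q)

  two-in⇒head : ∀ {u a b} → K a u ≡ true → K b u ≡ true → a ≢ b → ∃ λ i → h i ≡ u
  two-in⇒head {u} ka kb a≢b with kind u
  ... | head i p = i , p
  ... | tail i refl = contradiction ka (no-in-tail i)
  ... | free p q = contradiction (≤-trans (two-hits (λ v → K v u) ka kb a≢b) (m≤n+m _ (d⁺ K u))) (free-deg p q)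

  perfect⇒tail : n ≡ m + m → ∀ {u a} → K u a ≡ true → ∃ λ i → t i ≡ u
  perfect⇒tail n≡2m {u} k with kind u
  ... | tail i p = i , p
  ... | head i refl = contradiction k (no-out-head i)
  ... | free p q = contradiction (≤-trans (≤-reflexive (sym (υ-free p q))) (≤-trans (≤∑ υ u) (≤-reflexive ∑υ≡0))) λ ()
    where
    ∑υ≡0 : ∑ υ ≡ 0
    ∑υ≡0 = +-cancelʳ-≡ (m + m) (∑ υ) 0 (trans ∑υ n≡2m)

  m≤k : m ≤ arcs K
  m≤k = +-cancelʳ-≤ m m (arcs K) (≤-trans 2m≤n (≤-reflexive (trans (sym size) (arcs-split S))))

  n≡k+m : n ≡ arcs K + m
  n≡k+m = trans (sym size) (arcs-split S)

  Outcome : Set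
  Outcome = (n ≡ 4 × m ≡ 2 × A ≅ onFin n C4ss) ⊎ (n ≡ 6 × m ≡ 3 × A ≅ onFin n C4ppss)

  module _ {e₁ e₂ f₁ f₂ : Fin n} (e : K e₁ e₂ ≡ true) (f : K f₁ f₂ ≡ true) (e₁≢f₁ : e₁ ≢ f₁) (e₂≢f₂ : e₂ ≢ f₂) where

    e₁≢e₂ : e₁ ≢ e₂
    e₁≢e₂ refl = source-or-sink e e

    f₁≢f₂ : f₁ ≢ f₂
    f₁≢f₂ refl = source-or-sink f f

    e₁≢f₂ : e₁ ≢ f₂
    e₁≢f₂ refl = source-or-sink f e

    f₁≢e₂ : f₁ ≢ e₂
    f₁≢e₂ refl = source-or-sink e f

    clashing : ∀ {u v x y} → K u v ≡ true → K x y ≡ true → u ≢ x → v ≢ y → 1 ≤ ⟦ K u v ⟧ * clash K u v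
    clashing kuv kxy u≢x v≢y rewrite kuv = ≤-trans (clash-≥1 K kxy u≢x v≢y) (m≤m+n _ 0)

    -- The arcs `e` and `f` clash with each other and already account for 2 in `clashes K`; a third
    -- arc clashing with anything would raise the count to 3.
    other-coherent : ∀ {u v x y} → K u v ≡ true → (e₁ , e₂) ≢ (u , v) → (f₁ , f₂) ≢ (u , v) → K x y ≡ true → u ≡ x ⊎ v ≡ y
    other-coherent {u} {v} {x} {y} kuv ≢e ≢f kxy with u ≟ x | v ≟ y
    ... | yes p | _ = inj₁ p
    ... | no _ | yes q = inj₂ q
    ... | no u≢x | no v≢y = contradiction
      (≤-trans (∑₂-three (λ u v → ⟦ K u v ⟧ * clash K u v)
         (clashing e f e₁≢f₁ e₂≢f₂) (clashing f e (e₁≢f₁ ∘ sym) (e₂≢f₂ ∘ sym)) (clashing kuv kxy u≢x v≢y)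
         (λ { refl → e₁≢f₁ refl }) ≢e ≢f) clashes≤2)
      (λ { (s≤s (s≤s ())) })

    -- An arc coherent with both `e` and `f` cannot share its tail with both, nor its head with
    -- both, so it joins the tail of one to the head of the other.
    other-arc : ∀ {u v} → K u v ≡ true → (e₁ , e₂) ≢ (u , v) → (f₁ , f₂) ≢ (u , v) → (e₁ , f₂) ≡ (u , v) ⊎ (f₁ , e₂) ≡ (u , v)
    other-arc k ≢e ≢f with other-coherent k ≢e ≢f e | other-coherent k ≢e ≢f f
    ... | inj₁ refl | inj₁ refl = contradiction refl e₁≢f₁
    ... | inj₁ refl | inj₂ refl = inj₁ refl
    ... | inj₂ refl | inj₁ refl = inj₂ refl
    ... | inj₂ refl | inj₂ refl = contradiction refl e₂≢f₂

    -- Without cross arcs `K` consists of `e` and `f`, and `m ≤ arcs K` forces `m = 2`, `n = 4` and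
    -- a perfect matching. Then `e₁` and `f₁` are matched tails. The partner of `e₁` is neither
    -- `e₂`, as that arc lies in `K`, nor `f₁`, which emits an arc of `K`; so it is `f₂`, and
    -- symmetrically `f₁` is matched to `e₂`.
    four-cycle : K e₁ f₂ ≢ true → K f₁ e₂ ≢ true → Outcome
    four-cycle ¬g ¬g′ = inj₁ (n≡4 , m≡2 , ≅-from-labels A C4ss (lookup corners) ι-inj n≡4 maps (≤-reflexive (trans size n≡4)))
      where
      k≤2 : arcs K ≤ 2
      k≤2 = ≤-trans (∑₂-mono le) (≤-reflexive (trans (∑₂-+ (δ₂ (e₁ , e₂)) (δ₂ (f₁ , f₂))) (cong₂ _+_ (∑₂-δ₂ (e₁ , e₂)) (∑₂-δ₂ (f₁ , f₂)))))
        where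
        le : ∀ u v → ⟦ K u v ⟧ ≤ δ₂ (e₁ , e₂) u v + δ₂ (f₁ , f₂) u v
        le u v with K u v in k | pair? (e₁ , e₂) (u , v) | pair? (f₁ , f₂) (u , v)
        ... | false | _ | _ = z≤n
        ... | true | yes refl | _ = ≤-trans (δ₂-self (e₁ , e₂)) (m≤m+n _ _)
        ... | true | no _ | yes refl = ≤-trans (δ₂-self (f₁ , f₂)) (m≤n+m _ (δ₂ (e₁ , e₂) f₁ f₂))
        ... | true | no ≢e | no ≢f with other-arc k ≢e ≢f
        ... | inj₁ refl = contradiction k ¬g
        ... | inj₂ refl = contradiction k ¬g′
      m≡2 : m ≡ 2
      m≡2 = ≤-antisym (≤-trans m≤k k≤2) 2≤m
      n≡4 : n ≡ 4
      n≡4 = trans n≡k+m (cong₂ _+_ (≤-antisym k≤2 (≤-trans 2≤m m≤k)) m≡2)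
      corners : Vec (Fin n) 4
      corners = e₁ ∷ e₂ ∷ f₁ ∷ f₂ ∷ []
      ι-inj : ∀ {i j} → lookup corners i ≡ lookup corners j → i ≡ j
      ι-inj = lookup-injective ((e₁≢e₂ ∷ e₁≢f₁ ∷ e₁≢f₂ ∷ []) ∷ (f₁≢e₂ ∘ sym ∷ e₂≢f₂ ∷ []) ∷ (f₁≢f₂ ∷ []) ∷ [] ∷ []) _ _
      perfect : n ≡ m + m
      perfect = trans n≡4 (sym (cong₂ _+_ m≡2 m≡2))
      ef : A e₁ f₂ ≡ true
      ef with perfect⇒tail perfect e
      ... | i , refl with onto (lookup corners) ι-inj n≡4 (h i)
      ... | zero , q = contradiction q (t≢h i i)
      ... | suc zero , refl = contradiction e (K-matched i)
      ... | suc (suc zero) , refl = contradiction f (no-out-head i)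
      ... | suc (suc (suc zero)) , refl = matched i
      fe : A f₁ e₂ ≡ true
      fe with perfect⇒tail perfect f
      ... | i , refl with onto (lookup corners) ι-inj n≡4 (h i)
      ... | zero , refl = contradiction e (no-out-head i)
      ... | suc zero , refl = matched i
      ... | suc (suc zero) , q = contradiction q (t≢h i i)
      ... | suc (suc (suc zero)) , refl = contradiction f (K-matched i)
      maps : ∀ i j → C4ss (toℕ i) (toℕ j) ≡ true → A (lookup corners i) (lookup corners j) ≡ true
      maps zero (suc zero) _ = K⇒A e
      maps zero (suc (suc (suc zero))) _ = ef
      maps (suc (suc zero)) (suc zero) _ = fe
      maps (suc (suc zero)) (suc (suc (suc zero))) _ = K⇒A f
      maps zero zero ()
      maps zero (suc (suc zero)) ()
      maps (suc zero) j ()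
      maps (suc (suc zero)) zero ()
      maps (suc (suc zero)) (suc (suc zero)) ()
      maps (suc (suc (suc zero))) j ()

    -- `K` is the path `e₂ ← e₁ → f₂ ← f₁`. As `e₁` emits two arcs it is a matched tail, with a
    -- partner `z`; as `f₂` receives two it is a matched head, with a partner `s`. These six
    -- vertices are distinct, so `6 ≤ n = arcs K + m` with `m ≤ arcs K ≤ 3` gives `m = 3` and
    -- `n = 6`. The last matching arc can only be `f₁ → e₂`, which closes the cycle; `z` and `s` are
    -- its pendants.
    four-cycle-with-pendants : K e₁ f₂ ≡ true → Outcome
    four-cycle-with-pendants g = inj₂ (n≡6 , m≡3 , ≅-from-labels A C4ppss (lookup vertices) ι-inj n≡6 maps (≤-reflexive (trans size n≡6)))
      where
      k≤3 : arcs K ≤ 3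
      k≤3 = ≤-trans (∑₂-mono le) (≤-reflexive (trans (∑₂-+ (δ₂ (e₁ , e₂)) (λ u v → δ₂ (f₁ , f₂) u v + δ₂ (e₁ , f₂) u v))
          (cong₂ _+_ (∑₂-δ₂ (e₁ , e₂)) (trans (∑₂-+ (δ₂ (f₁ , f₂)) (δ₂ (e₁ , f₂))) (cong₂ _+_ (∑₂-δ₂ (f₁ , f₂)) (∑₂-δ₂ (e₁ , f₂)))))))
        where
        le : ∀ u v → ⟦ K u v ⟧ ≤ δ₂ (e₁ , e₂) u v + (δ₂ (f₁ , f₂) u v + δ₂ (e₁ , f₂) u v)
        le u v with K u v in k | pair? (e₁ , e₂) (u , v) | pair? (f₁ , f₂) (u , v)
        ... | false | _ | _ = z≤n
        ... | true | yes refl | _ = ≤-trans (δ₂-self (e₁ , e₂)) (m≤m+n _ _)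
        ... | true | no _ | yes refl = ≤-trans (δ₂-self (f₁ , f₂)) (≤-trans (m≤m+n _ _) (m≤n+m _ (δ₂ (e₁ , e₂) f₁ f₂)))
        ... | true | no ≢e | no ≢f with other-arc k ≢e ≢f
        ... | inj₁ refl = ≤-trans (δ₂-self (e₁ , f₂)) (≤-trans (m≤n+m _ (δ₂ (f₁ , f₂) e₁ f₂)) (m≤n+m _ (δ₂ (e₁ , e₂) e₁ f₂)))
        -- The second cross arc `f₁ → e₂` would clash with `g`.
        ... | inj₂ refl with other-coherent k ≢e ≢f g
        ... | inj₁ q = contradiction (sym q) e₁≢f₁
        ... | inj₂ q = contradiction q e₂≢f₂
      tail-e = two-out⇒tail e g e₂≢f₂
      head-f = two-in⇒head f g (e₁≢f₁ ∘ sym)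
      i₁ = proj₁ tail-e
      i₂ = proj₁ head-f
      z s : Fin n
      z = h i₁
      s = t i₂
      t₁ : t i₁ ≡ e₁
      t₁ = proj₂ tail-e
      h₂ : h i₂ ≡ f₂
      h₂ = proj₂ head-f
      ¬K-e₁z : K e₁ z ≢ true
      ¬K-e₁z k = K-matched i₁ (trans (cong (λ u → K u z) t₁) k)
      ¬K-sf₂ : K s f₂ ≢ true
      ¬K-sf₂ k = K-matched i₂ (trans (cong (K s) h₂) k)
      i₁≢i₂ : i₁ ≢ i₂
      i₁≢i₂ q = ¬K-e₁z (trans (cong (K e₁) (trans (cong h q) h₂)) g)
      vertices : Vec (Fin n) 6
      vertices = e₁ ∷ f₂ ∷ f₁ ∷ e₂ ∷ z ∷ s ∷ []
      ι-inj : ∀ {i j} → lookup vertices i ≡ lookup vertices j → i ≡ j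
      ι-inj = lookup-injective
        ( (e₁≢f₂ ∷ e₁≢f₁ ∷ e₁≢e₂ ∷ (λ q → t≢h i₁ i₁ (trans t₁ q)) ∷ (λ q → i₁≢i₂ (t-inj (trans t₁ q))) ∷ [])
        ∷ (f₁≢f₂ ∘ sym ∷ e₂≢f₂ ∘ sym ∷ (λ q → i₁≢i₂ (sym (h-inj (trans h₂ q)))) ∷ (λ q → t≢h i₂ i₂ (sym (trans h₂ q))) ∷ [])
        ∷ (f₁≢e₂ ∷ (λ q → no-out-head i₁ (subst (λ u → K u f₂ ≡ true) q f)) ∷ (λ q → ¬K-sf₂ (subst (λ u → K u f₂ ≡ true) q f)) ∷ [])
        ∷ ((λ q → ¬K-e₁z (subst (λ u → K e₁ u ≡ true) q e)) ∷ (λ q → no-in-tail i₂ (subst (λ u → K e₁ u ≡ true) q e)) ∷ [])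
        ∷ ((λ q → t≢h i₂ i₁ (sym q)) ∷ [])
        ∷ [] ∷ []) _ _
      6≤n : 6 ≤ n
      6≤n = injective⇒≤ (λ {i} {j} → ι-inj {i} {j})
      m≡3 : m ≡ 3
      m≡3 = ≤-antisym (≤-trans m≤k k≤3) (+-cancelˡ-≤ 3 3 m (≤-trans 6≤n (≤-trans (≤-reflexive n≡k+m) (+-monoˡ-≤ m k≤3))))
      n≡6 : n ≡ 6
      n≡6 = ≤-antisym (≤-trans (≤-reflexive n≡k+m) (+-mono-≤ k≤3 (≤-reflexive m≡3))) 6≤n
      fe : A f₁ e₂ ≡ true
      fe with perfect⇒tail (trans n≡6 (sym (cong₂ _+_ m≡3 m≡3))) f
      ... | i , q₁ with onto (lookup vertices) ι-inj n≡6 (h i)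
      ... | zero , q = contradiction (trans t₁ q) (t≢h i₁ i)
      ... | suc zero , q = contradiction (trans (cong₂ K q₁ (sym q)) f) (K-matched i)
      ... | suc (suc zero) , q = contradiction (trans q₁ q) (t≢h i i)
      ... | suc (suc (suc zero)) , q = trans (cong₂ A (sym q₁) q) (matched i)
      ... | suc (suc (suc (suc zero))) , q = contradiction (trans (sym t₁) (trans (cong t (h-inj q)) q₁)) e₁≢f₁
      ... | suc (suc (suc (suc (suc zero)))) , q = contradiction q (t≢h i₂ i)
      maps : ∀ i j → C4ppss (toℕ i) (toℕ j) ≡ true → A (lookup vertices i) (lookup vertices j) ≡ true
      maps zero (suc zero) _ = K⇒A g
      maps zero (suc (suc (suc zero))) _ = K⇒A e
      maps zero (suc (suc (suc (suc zero)))) _ = trans (cong (λ u → A u z) (sym t₁)) (matched i₁)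
      maps (suc (suc zero)) (suc zero) _ = K⇒A f
      maps (suc (suc zero)) (suc (suc (suc zero))) _ = fe
      maps (suc (suc (suc (suc (suc zero))))) (suc zero) _ = trans (cong (A s) (sym h₂)) (matched i₂)
      maps zero zero ()
      maps zero (suc (suc zero)) ()
      maps zero (suc (suc (suc (suc (suc zero))))) ()
      maps (suc zero) j ()
      maps (suc (suc zero)) zero ()
      maps (suc (suc zero)) (suc (suc zero)) ()
      maps (suc (suc zero)) (suc (suc (suc (suc zero)))) ()
      maps (suc (suc zero)) (suc (suc (suc (suc (suc zero))))) ()
      maps (suc (suc (suc zero))) j ()
      maps (suc (suc (suc (suc zero)))) j ()
      maps (suc (suc (suc (suc (suc zero))))) zero ()
      maps (suc (suc (suc (suc (suc zero))))) (suc (suc zero)) ()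
      maps (suc (suc (suc (suc (suc zero))))) (suc (suc (suc zero))) ()
      maps (suc (suc (suc (suc (suc zero))))) (suc (suc (suc (suc zero)))) ()
      maps (suc (suc (suc (suc (suc zero))))) (suc (suc (suc (suc (suc zero))))) ()

  clash⇒four-cycle : ∀ {e₁ e₂ f₁ f₂} → K e₁ e₂ ≡ true → K f₁ f₂ ≡ true → e₁ ≢ f₁ → e₂ ≢ f₂ → Outcome
  clash⇒four-cycle {e₁} {e₂} {f₁} {f₂} e f e₁≢f₁ e₂≢f₂ with ≡true? (K e₁ f₂) | ≡true? (K f₁ e₂)
  ... | yes g | _ = four-cycle-with-pendants e f e₁≢f₁ e₂≢f₂ g
  ... | no _ | yes g = four-cycle-with-pendants f e (e₁≢f₁ ∘ sym) (e₂≢f₂ ∘ sym) g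
  ... | no ¬g | no ¬g′ = four-cycle e f e₁≢f₁ e₂≢f₂ ¬g ¬g′

-- From the graph and its matching to a split

module _ {G : Graph n} {A : Digraph n} (oriented : IsOrientation G A) where

  loopless : ∀ u → A u u ≢ true
  loopless u a = contradiction (trans (sym a) (proj₂ oriented u u a)) λ ()

  -- An edge with `u < v` is either an arc going up or an arc going down. Transposing the second sum
  -- makes every arc appear once, because there are no loops.
  arcs-edges : arcs A ≡ edgeCount G
  arcs-edges = sym (begin
    edgeCount G
      ≡⟨ trans (Σℕ≡∑ n (λ u → count n (λ v → (toℕ u <ᵇ toℕ v) ∧ E G u v)))
               (sum-cong-≗ (λ u → Σℕ≡∑ n (λ v → ⟦ (toℕ u <ᵇ toℕ v) ∧ E G u v ⟧))) ⟩
    ∑₂ (λ u v → ⟦ (toℕ u <ᵇ toℕ v) ∧ E G u v ⟧)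
      ≡⟨ ∑₂-cong edge ⟩
    ∑₂ (λ u v → ⟦ toℕ u <ᵇ toℕ v ⟧ * ⟦ A u v ⟧ + ⟦ toℕ u <ᵇ toℕ v ⟧ * ⟦ A v u ⟧)
      ≡⟨ ∑₂-+ (λ u v → ⟦ toℕ u <ᵇ toℕ v ⟧ * ⟦ A u v ⟧) (λ u v → ⟦ toℕ u <ᵇ toℕ v ⟧ * ⟦ A v u ⟧) ⟩
    ∑₂ up + ∑₂ (λ u v → ⟦ toℕ u <ᵇ toℕ v ⟧ * ⟦ A v u ⟧)
      ≡⟨ cong (∑₂ up +_) (∑-comm (λ u v → ⟦ toℕ u <ᵇ toℕ v ⟧ * ⟦ A v u ⟧)) ⟩
    ∑₂ up + ∑₂ down
      ≡⟨ ∑₂-+ up down ⟨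
    ∑₂ (λ u v → up u v + down u v)
      ≡⟨ ∑₂-cong either-way ⟩
    arcs A ∎)
    where
    open ≡-Reasoning
    up down : Fin n → Fin n → ℕ
    up u v = ⟦ toℕ u <ᵇ toℕ v ⟧ * ⟦ A u v ⟧
    down u v = ⟦ toℕ v <ᵇ toℕ u ⟧ * ⟦ A u v ⟧
    disjoint : ∀ x a b → (a ≡ true → b ≡ false) → ⟦ x ∧ (a ∨ b) ⟧ ≡ ⟦ x ⟧ * ⟦ a ⟧ + ⟦ x ⟧ * ⟦ b ⟧
    disjoint true true b p rewrite p refl = refl
    disjoint true false true _ = refl
    disjoint true false false _ = refl
    disjoint false a b _ = refl
    edge : ∀ u v → ⟦ (toℕ u <ᵇ toℕ v) ∧ E G u v ⟧ ≡ ⟦ toℕ u <ᵇ toℕ v ⟧ * ⟦ A u v ⟧ + ⟦ toℕ u <ᵇ toℕ v ⟧ * ⟦ A v u ⟧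
    edge u v rewrite proj₁ oriented u v = disjoint (toℕ u <ᵇ toℕ v) (A u v) (A v u) (proj₂ oriented u v)
    <ᵇ-true : ∀ {a b} → a < b → ⟦ a <ᵇ b ⟧ ≡ 1
    <ᵇ-true {a} {b} p with a <ᵇ b | <⇒<ᵇ p
    ... | true | _ = refl
    <ᵇ-false : ∀ {a b} → b ≤ a → ⟦ a <ᵇ b ⟧ ≡ 0
    <ᵇ-false {a} {b} p with a <ᵇ b in eq
    ... | false = refl
    ... | true = contradiction (<ᵇ⇒< a b (subst T (sym eq) tt)) (≤⇒≯ p)
    either-way : ∀ u v → up u v + down u v ≡ ⟦ A u v ⟧
    either-way u v with <-cmp (toℕ u) (toℕ v)
    ... | tri< u<v _ _ = trans (cong₂ (λ x y → x * ⟦ A u v ⟧ + y * ⟦ A u v ⟧) (<ᵇ-true u<v) (<ᵇ-false (<⇒≤ u<v)))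
                               (trans (+-identityʳ _) (+-identityʳ _))
    ... | tri> _ _ v<u = trans (cong₂ (λ x y → x * ⟦ A u v ⟧ + y * ⟦ A u v ⟧) (<ᵇ-false (<⇒≤ v<u)) (<ᵇ-true v<u))
                               (+-identityʳ _)
    ... | tri≈ _ e _ with toℕ-injective e
    ... | refl with A u u in loop
    ... | true = contradiction loop (loopless u)
    ... | false = cong₂ _+_ (*-zeroʳ ⟦ toℕ u <ᵇ toℕ u ⟧) (*-zeroʳ ⟦ toℕ u <ᵇ toℕ u ⟧)

  -- The first edge of a walk from `u` to any other vertex is an arc at `u`. This positivity is what
  -- the waste at unmatched vertices relies on.
  connected⇒deg≥1 : Connected G → 2 ≤ n → ∀ u → 1 ≤ d⁺ A u + d⁻ A u
  connected⇒deg≥1 connected 2≤n u = incident (connected u (proj₁ another)) (proj₂ another)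
    where
    other : ∀ {n} → 2 ≤ n → (u : Fin n) → ∃ λ v → v ≢ u
    other (s≤s (s≤s _)) zero = suc zero , λ ()
    other (s≤s (s≤s _)) (suc u) = zero , λ ()
    another = other 2≤n u
    incident : ∀ {v} → Reach G u v → v ≢ u → 1 ≤ d⁺ A u + d⁻ A u
    incident here v≢u = contradiction refl v≢u
    incident (step {v = w} edge _) _ with A u w in a | A w u in a′ | trans (sym (proj₁ oriented u w)) edge
    ... | true | _ | _ = ≤-trans (≤-trans (≤-reflexive (sym (cong ⟦_⟧ a))) (≤∑ (λ w → ⟦ A u w ⟧) w)) (m≤m+n _ _)
    ... | false | true | _ = ≤-trans (≤-trans (≤-reflexive (sym (cong ⟦_⟧ a′))) (≤∑ (λ w → ⟦ A w u ⟧) w)) (m≤n+m _ (d⁺ A u))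

  matching⇒split : (M : Fin m → Fin n × Fin n) → IsMatching G M → Split A m
  matching⇒split {m = m} M (edges , disjoint) = record
    { K = K ; t = t ; h = h ; t-inj = t-inj ; h-inj = h-inj ; t≢h = t≢h ; split = split }
    where
    End : Fin m → Fin n → Set
    End i x = x ≡ proj₁ (M i) ⊎ x ≡ proj₂ (M i)

    orient : ∀ i → ∃₂ λ a b → A a b ≡ true × End i a × End i b
    orient i with A (proj₁ (M i)) (proj₂ (M i)) in a | A (proj₂ (M i)) (proj₁ (M i)) in a′
                | trans (sym (proj₁ oriented (proj₁ (M i)) (proj₂ (M i)))) (edges i)
    ... | true | _ | _ = _ , _ , a , inj₁ refl , inj₂ refl
    ... | false | true | _ = _ , _ , a′ , inj₂ refl , inj₁ refl

    t h : Fin m → Fin n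
    t i = proj₁ (orient i)
    h i = proj₁ (proj₂ (orient i))

    arc : ∀ i → A (t i) (h i) ≡ true
    arc i = proj₁ (proj₂ (proj₂ (orient i)))

    t-end : ∀ i → End i (t i)
    t-end i = proj₁ (proj₂ (proj₂ (proj₂ (orient i))))

    h-end : ∀ i → End i (h i)
    h-end i = proj₂ (proj₂ (proj₂ (proj₂ (orient i))))

    ends-apart : ∀ {i j x y} → i ≢ j → End i x → End j y → x ≢ y
    ends-apart {i} {j} i≢j p q with disjoint i j i≢j
    ends-apart i≢j (inj₁ refl) (inj₁ refl) | d , _ = d
    ends-apart i≢j (inj₁ refl) (inj₂ refl) | _ , d , _ = d
    ends-apart i≢j (inj₂ refl) (inj₁ refl) | _ , _ , d , _ = d
    ends-apart i≢j (inj₂ refl) (inj₂ refl) | _ , _ , _ , d = d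

    t-inj : ∀ {i j} → t i ≡ t j → i ≡ j
    t-inj {i} {j} e with i ≟ j
    ... | yes i≡j = i≡j
    ... | no i≢j = contradiction e (ends-apart i≢j (t-end i) (t-end j))

    h-inj : ∀ {i j} → h i ≡ h j → i ≡ j
    h-inj {i} {j} e with i ≟ j
    ... | yes i≡j = i≡j
    ... | no i≢j = contradiction e (ends-apart i≢j (h-end i) (h-end j))

    t≢h : ∀ i j → t i ≢ h j
    t≢h i j e with i ≟ j
    ... | yes refl = loopless (h i) (trans (cong (λ u → A u (h i)) (sym e)) (arc i))
    ... | no i≢j = ends-apart i≢j (t-end i) (h-end j) e

    matched? : ∀ u v → Dec (∃ λ i → t i ≡ u × h i ≡ v)
    matched? u v = any? (λ i → t i ≟ u ×-dec h i ≟ v)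

    K : Digraph n
    K u v = A u v ∧ not (does (matched? u v))

    split : ∀ u v → ⟦ A u v ⟧ ≡ ⟦ K u v ⟧ + ∑ (λ i → δ₂ (t i , h i) u v)
    split u v with matched? u v
    ... | no ¬p = trans (cong ⟦_⟧ (sym (∧-identityʳ (A u v)))) (sym (trans (cong (⟦ A u v ∧ true ⟧ +_)
                    (∑-zero (λ i → δ₂-≢ {e = t i , h i} (λ { refl → ¬p (i , refl , refl) })))) (+-identityʳ _)))
    ... | yes (i , refl , refl) = trans (cong ⟦_⟧ (arc i)) (sym (cong₂ _+_ (cong ⟦_⟧ (∧-zeroʳ (A (t i) (h i))))
                    (trans (sum-cong-≗ same) (∑-δ₁ i))))
      where
      same : ∀ j → δ (t j) (t i) * δ (h j) (h i) ≡ δ i j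
      same j with i ≟ j
      ... | yes refl = cong₂ _*_ (δ-refl (t i)) (δ-refl (h i))
      ... | no i≢j = cong (_* δ (h j) (h i)) (δ-≢ (λ e → i≢j (sym (t-inj e))))

-- Orientations of deficit at most 2

≅-transpose : {A B : Digraph n} → transpose A ≅ B → A ≅ transpose B
≅-transpose (σ , iso) = σ , λ u v → iso v u

no-clash⇒coherent : (K : Digraph n) → clashes K ≡ 0 → Coherent K
no-clash⇒coherent K Y {a} {b} {c} {d} ab cd with a ≟ c | b ≟ d
... | yes q | _ = inj₁ q
... | no _ | yes q = inj₂ q
... | no a≢c | no b≢d = contradiction (begin
    1                                ≤⟨ clash-≥1 K cd a≢c b≢d ⟩
    clash K a b                      ≡⟨ *-identityˡ _ ⟨
    1 * clash K a b                  ≡⟨ cong (λ x → ⟦ x ⟧ * clash K a b) ab ⟨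
    ⟦ K a b ⟧ * clash K a b          ≤⟨ ≤∑ (λ b → ⟦ K a b ⟧ * clash K a b) b ⟩
    _                                ≤⟨ ≤∑ (λ a → ∑ (λ b → ⟦ K a b ⟧ * clash K a b)) a ⟩
    clashes K                        ≡⟨ Y ⟩
    0                                ∎) λ ()
  where open ≤-Reasoning

Clashing : Digraph n → Set
Clashing K = ∃₂ λ e₁ e₂ → ∃₂ λ f₁ f₂ → K e₁ e₂ ≡ true × K f₁ f₂ ≡ true × e₁ ≢ f₁ × e₂ ≢ f₂

clashes≥1⇒clashing : (K : Digraph n) → 1 ≤ clashes K → Clashing K
clashes≥1⇒clashing K p with ∑₂-pos (λ u v → ⟦ K u v ⟧ * clash K u v) p
... | e₁ , e₂ , q with K e₁ e₂ in e
... | true with clash-witness K e₁ e₂ (≤-trans q (≤-reflexive (+-identityʳ _)))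
... | f₁ , f₂ , f , e₁≢f₁ , e₂≢f₂ = e₁ , e₂ , f₁ , f₂ , e , f , e₁≢f₁ , e₂≢f₂

-- Two distinct coherent arcs share exactly one end. If it is the tail, their heads differ, so an
-- arc coherent with both cannot meet both of them in its head and must leave the common tail; a
-- common head is symmetric.
coherent⇒star : (K : Digraph n) → Coherent K → 2 ≤ arcs K →
  (∃ λ w → (∀ {x y} → K x y ≡ true → x ≡ w)) ⊎ (∃ λ w → (∀ {x y} → K x y ≡ true → y ≡ w))
coherent⇒star K coherent k≥2 with ∑₂-pos (λ u v → ⟦ K u v ⟧) (≤-trans (s≤s z≤n) k≥2)
... | u , v , e with ∑₂-other (λ u v → ⟦ K u v ⟧) (u , v) (λ u v → ⟦⟧≤1 (K u v)) k≥2
... | x , y , f , e≢f with coherent (⟦⟧≥1 e) (⟦⟧≥1 f)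
... | inj₁ refl = inj₁ (u , from-u)
  where
  from-u : ∀ {a b} → K a b ≡ true → a ≡ u
  from-u k with coherent k (⟦⟧≥1 e) | coherent k (⟦⟧≥1 f)
  ... | inj₁ q | _ = q
  ... | inj₂ _ | inj₁ q = q
  ... | inj₂ refl | inj₂ refl = contradiction refl e≢f
... | inj₂ refl = inj₂ (v , to-v)
  where
  to-v : ∀ {b a} → K b a ≡ true → a ≡ v
  to-v k with coherent k (⟦⟧≥1 e) | coherent k (⟦⟧≥1 f)
  ... | inj₂ q | _ = q
  ... | inj₁ _ | inj₂ q = q
  ... | inj₁ refl | inj₁ refl = contradiction refl e≢f

InUStar⇒zagreb : ∀ p s (D : Digraph (3 + (p * 2 + suc s))) → InUStar (3 + (p * 2 + suc s)) (2 + p) D →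
  zagreb D + 2 ≡ excess (1 + p + suc s) (2 + p)
InUStar⇒zagreb p s D = cases
  where
  k≡n∸m : 3 + (p * 2 + suc s) ∸ (2 + p) ≡ 1 + p + suc s
  k≡n∸m = trans (cong (_∸ (2 + p)) (arith p (suc s))) (m+n∸n≡m (1 + p + suc s) (2 + p))
    where
    arith : ∀ p s → 3 + (p * 2 + s) ≡ 1 + p + s + (2 + p)
    arith = solve-∀
  -- `n` and `m` are variables here so that matching on `refl` turns them into numerals, for which
  -- the required value is checked by evaluation; the concrete size `3 + (p * 2 + suc s)` does not
  -- unify with 4 or 6.
  sporadic : ∀ {n m f} (R : ℕ → ℕ → Bool) N M → zagreb (onFin N R) + 2 ≡ excess (N ∸ M) M → n ≡ N → m ≡ M →
    (D : Digraph n) → zagreb D ≡ f → D ≅ onFin n R → f + 2 ≡ excess (n ∸ m) m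
  sporadic R N M eq refl refl D refl iso = trans (cong (_+ 2) (zagreb-≅ {A = D} {onFin N R} iso)) eq
  cases : InUStar (3 + (p * 2 + suc s)) (2 + p) D → zagreb D + 2 ≡ excess (1 + p + suc s) (2 + p)
  cases (inj₁ (b , iso)) = trans (cong (_+ 2) (zagreb-≅ {A = D} {Model.U p (suc s) b} iso)) (Model.zagreb-U p (suc s) b)
  cases (inj₂ (inj₁ (b , iso))) = trans (cong (_+ 2) (trans (zagreb-≅ {A = D} {transpose (Model.U p (suc s) b)} iso) (zagreb-transpose (Model.U p (suc s) b)))) (Model.zagreb-U p (suc s) b)
  cases (inj₂ (inj₂ (inj₁ (n≡4 , m≡2 , inj₁ iso)))) = trans (sporadic C4ss 4 2 refl n≡4 m≡2 D refl iso) (cong (λ k → excess k (2 + p)) k≡n∸m)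
  cases (inj₂ (inj₂ (inj₁ (n≡4 , m≡2 , inj₂ iso)))) = trans (sporadic (reverse C4ss) 4 2 refl n≡4 m≡2 D refl iso) (cong (λ k → excess k (2 + p)) k≡n∸m)
  cases (inj₂ (inj₂ (inj₂ (n≡6 , m≡3 , inj₁ iso)))) = trans (sporadic C4ppss 6 3 refl n≡6 m≡3 D refl iso) (cong (λ k → excess k (2 + p)) k≡n∸m)
  cases (inj₂ (inj₂ (inj₂ (n≡6 , m≡3 , inj₂ iso)))) = trans (sporadic (reverse C4ppss) 6 3 refl n≡6 m≡3 D refl iso) (cong (λ k → excess k (2 + p)) k≡n∸m)

module _ (p s : ℕ) {A : Digraph (3 + (p * 2 + suc s))} (S : Split A (2 + p))
  (size : arcs A ≡ 3 + (p * 2 + suc s)) (noLoop : ∀ u → A u u ≢ true) where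
  open Split S

  n₁ m₁ : ℕ
  n₁ = 3 + (p * 2 + suc s)
  m₁ = 2 + p

  k≡ : arcs K ≡ 1 + p + suc s
  k≡ = +-cancelʳ-≡ m₁ (arcs K) (1 + p + suc s) (trans (trans (sym (arcs-split S)) size) (arith p (suc s)))
    where
    arith : ∀ p s → 3 + (p * 2 + s) ≡ 1 + p + s + (2 + p)
    arith = solve-∀

  k≥2 : 2 ≤ arcs K
  k≥2 = ≤-trans (s≤s (≤-trans (s≤s z≤n) (m≤n+m (suc s) p))) (≤-reflexive (sym k≡))

  ∑waste-transpose : ∑ (waste (transposeSplit S)) ≡ ∑ (waste S)
  ∑waste-transpose = sum-cong-≗ (λ u → cong₂ _+_ (+-comm (d⁻ K u * τ u) (d⁺ K u * η u))
    (cong₂ (λ x y → (1 ∸ x) * (y ∸ 1)) (+-comm (η u) (τ u)) (+-comm (d⁻ K u) (d⁺ K u))))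

  out-star⇒InUStar : ∀ w → (∀ {x y} → K x y ≡ true → x ≡ w) → ∑ (waste S) ≤ 1 → InUStar n₁ m₁ A
  out-star⇒InUStar w from-w Z≤1 = inj₁ (false , star⇒≅ p s S (out-star S size noLoop w from-w k≥2 Z≤1) size)

  in-star⇒InUStar : ∀ w → (∀ {x y} → K x y ≡ true → y ≡ w) → ∑ (waste S) ≤ 1 → InUStar n₁ m₁ A
  in-star⇒InUStar w to-w Z≤1 = inj₂ (inj₁ (false , ≅-transpose {A = A} {Model.U p (suc s) false} (star⇒≅ p s Sᵀ star sizeᵀ)))
    where
    Sᵀ : Split (transpose A) m₁
    Sᵀ = transposeSplit S
    sizeᵀ : arcs (transpose A) ≡ n₁
    sizeᵀ = trans (∑d⁻ A) size
    star : Star Sᵀ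
    star = out-star Sᵀ sizeᵀ noLoop w to-w (≤-trans k≥2 (≤-reflexive (sym (∑d⁻ K)))) (≤-trans (≤-reflexive ∑waste-transpose) Z≤1)

  coherent⇒InUStar : Coherent K → ∑ (waste S) ≤ 1 → InUStar n₁ m₁ A
  coherent⇒InUStar coherent Z≤1 = star (coherent⇒star K coherent k≥2)
    where
    star : (∃ λ w → (∀ {x y} → K x y ≡ true → x ≡ w)) ⊎ (∃ λ w → (∀ {x y} → K x y ≡ true → y ≡ w)) → InUStar n₁ m₁ A
    star (inj₁ (w , from-w)) = out-star⇒InUStar w from-w Z≤1
    star (inj₂ (w , to-w)) = in-star⇒InUStar w to-w Z≤1

  clash⇒InUStar : Clashing K → clashes K ≤ 2 → (∀ u → waste S u ≡ 0) → InUStar n₁ m₁ A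
  clash⇒InUStar (_ , _ , _ , _ , e , f , e₁≢f₁ , e₂≢f₂) clashes≤2 no-waste =
      sporadic (FourCycle.clash⇒four-cycle S size (s≤s (s≤s z≤n)) 2m≤n no-waste clashes≤2 e f e₁≢f₁ e₂≢f₂)
    where
    2m≤n : m₁ + m₁ ≤ n₁
    2m≤n = ≤-trans (m≤m+n (m₁ + m₁) s) (≤-reflexive (arith p s))
      where
      arith : ∀ p s → (2 + p) + (2 + p) + s ≡ 3 + (p * 2 + suc s)
      arith = solve-∀
    sporadic : (n₁ ≡ 4 × m₁ ≡ 2 × A ≅ onFin n₁ C4ss) ⊎ (n₁ ≡ 6 × m₁ ≡ 3 × A ≅ onFin n₁ C4ppss) → InUStar n₁ m₁ A
    sporadic (inj₁ (n≡ , m≡ , iso)) = inj₂ (inj₂ (inj₁ (n≡ , m≡ , inj₁ iso)))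
    sporadic (inj₂ (n≡ , m≡ , iso)) = inj₂ (inj₂ (inj₂ (n≡ , m≡ , inj₁ iso)))

  -- Without clashes the budget leaves a total waste of at most 1, the star case. With a clash, one
  -- wasted arc would already push the deficit to 3, so nothing is wasted.
  small-deficit⇒InUStar : clashes K + 2 * ∑ (waste S) ≤ 2 → InUStar n₁ m₁ A
  small-deficit⇒InUStar = by-size (clashes K) (∑ (waste S)) refl refl
    where
    by-size : ∀ y z → clashes K ≡ y → ∑ (waste S) ≡ z → y + 2 * z ≤ 2 → InUStar n₁ m₁ A
    by-size zero z Y Z W≤2 = coherent⇒InUStar (no-clash⇒coherent K Y) (≤-trans (≤-reflexive Z) (*-cancelˡ-≤ 2 W≤2))
    by-size (suc y) zero Y Z W≤2 = clash⇒InUStar (clashes≥1⇒clashing K (≤-trans (s≤s z≤n) (≤-reflexive (sym Y))))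
      (≤-trans (≤-reflexive (trans Y (sym (+-identityʳ _)))) W≤2)
      (λ u → n≤0⇒n≡0 (≤-trans (≤∑ (waste S) u) (≤-reflexive Z)))
    by-size (suc y) (suc z) _ _ W≤2 = contradiction
      (≤-trans (+-mono-≤ (s≤s (z≤n {y})) (*-monoʳ-≤ 2 (s≤s (z≤n {z})))) W≤2) λ { (s≤s (s≤s ())) }

open import Data.Integer using (ℤ; +_; -_; +≤+) renaming (_+_ to _+ℤ_; _*_ to _*ℤ_; _-_ to _-ℤ_; _≤_ to _≤ℤ_)
import Data.Integer.Properties as ℤₚ
import Data.Integer.Tactic.RingSolver as ℤ-Solver
open import Data.Rational using (_/_) renaming (_≤_ to _≤ℚ_)
open import Data.Rational.Properties using (/-injective-≃; toℚᵘ-cancel-≤; toℚᵘ-fromℚᵘ)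
open import Data.Rational.Unnormalised using (mkℚᵘ; *≡*; *≤*)
import Data.Rational.Unnormalised.Properties as ℚᵘₚ
open import Function.Bundles using (_⇔_; mk⇔)

M₁-zagreb : (A : Digraph n) → M₁ A ≡ + zagreb A / 2
M₁-zagreb {n} A = cong (λ s → + s / 2) (trans (Σℕ≡∑ n _) (sum-cong-≗ (λ u → trans (Σℕ≡∑ n _) (sum-cong-≗ (term u)))))
  where
  term : ∀ u v → (if A u v then outdeg A u + indeg A v else 0) ≡ ⟦ A u v ⟧ * (d⁺ A u + d⁻ A v)
  term u v with A u v
  ... | true = trans (cong₂ _+_ (Σℕ≡∑ n _) (Σℕ≡∑ n _)) (sym (+-identityʳ _))
  ... | false = refl

-- Passage to ℚ

half-injective : ∀ i j → i / 2 ≡ j / 2 → i ≡ j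
half-injective i j eq with /-injective-≃ (mkℚᵘ i 1) (mkℚᵘ j 1) eq
... | *≡* p = ℤₚ.*-cancelʳ-≡ i j (+ 2) p

half-mono : ∀ {i j} → i ≤ℤ j → i / 2 ≤ℚ j / 2
half-mono {i} {j} i≤j = toℚᵘ-cancel-≤ (ℚᵘₚ.≤-trans (ℚᵘₚ.≤-reflexive (toℚᵘ-fromℚᵘ (mkℚᵘ i 1)))
  (ℚᵘₚ.≤-trans (*≤* (ℤₚ.*-monoʳ-≤-nonNeg (+ 2) i≤j)) (ℚᵘₚ.≤-reflexive (ℚᵘₚ.≃-sym (toℚᵘ-fromℚᵘ (mkℚᵘ j 1))))))

bound : ℕ → ℕ → ℤ
bound n m = (+ n *ℤ + n) +ℤ ((- (+ 2 *ℤ + m) +ℤ + 3) *ℤ + n) +ℤ (+ m *ℤ + m) +ℤ + m -ℤ + 2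

-- With `n = k + m` the terms `n² - 2mn + m²` collapse to `k²`, and `3n + m` becomes `3k + 4m`.
bound-excess : ∀ k m → bound (k + m) m ≡ + excess k m -ℤ + 2
bound-excess k m = trans (expand (+ k) (+ m))
  (cong (_-ℤ + 2) (sym (cong₂ _+ℤ_ (cong₂ _+ℤ_ (ℤₚ.pos-* k k) (ℤₚ.pos-* 3 k)) (ℤₚ.pos-* 4 m))))
  where
  expand : ∀ x y → ((x +ℤ y) *ℤ (x +ℤ y)) +ℤ ((- (+ 2 *ℤ y) +ℤ + 3) *ℤ (x +ℤ y)) +ℤ (y *ℤ y) +ℤ y -ℤ + 2
                 ≡ x *ℤ x +ℤ + 3 *ℤ x +ℤ + 4 *ℤ y -ℤ + 2
  expand = ℤ-Solver.solve-∀

≤-bound : ∀ {f s} → f + 2 ≤ s → + f ≤ℤ + s -ℤ + 2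
≤-bound {f} p = ℤₚ.≤-trans (ℤₚ.≤-reflexive (cancel (+ f))) (ℤₚ.+-monoˡ-≤ (- (+ 2)) (+≤+ p))
  where
  cancel : ∀ x → x ≡ x +ℤ + 2 -ℤ + 2
  cancel = ℤ-Solver.solve-∀

≡-bound : ∀ {f s} → f + 2 ≡ s → + f ≡ + s -ℤ + 2
≡-bound {f} refl = cancel (+ f)
  where
  cancel : ∀ x → x ≡ x +ℤ + 2 -ℤ + 2
  cancel = ℤ-Solver.solve-∀

bound-≡ : ∀ {f s} → + f ≡ + s -ℤ + 2 → f + 2 ≡ s
bound-≡ {f} {s} p = ℤₚ.+-injective (trans (cong (_+ℤ + 2) p) (cancel (+ s)))
  where
  cancel : ∀ x → x -ℤ + 2 +ℤ + 2 ≡ x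
  cancel = ℤ-Solver.solve-∀

-- `p = m - 2` is the number of attached paths and `suc s = n - 2m + 1` the number of pendants,
-- which is never zero.
shape : ∀ {n m} → 2 ≤ m → 2 * m ≤ n → ∃₂ λ p s → m ≡ 2 + p × n ≡ 3 + (p * 2 + suc s)
shape 2≤m 2m≤n with m≤n⇒∃[o]m+o≡n 2≤m
... | p , refl with m≤n⇒∃[o]m+o≡n 2m≤n
... | s , refl = p , s , refl , arith p s
  where
  arith : ∀ p s → 2 * (2 + p) + s ≡ 3 + (p * 2 + suc s)
  arith = solve-∀

sharp-bound : ∀ p s {A : Digraph (3 + (p * 2 + suc s))} (S : Split A (2 + p)) → arcs A ≡ 3 + (p * 2 + suc s) →
  (∀ u → A u u ≢ true) → (∀ u → 1 ≤ d⁺ A u + d⁻ A u) →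
  (M₁ A ≤ℚ bound (3 + (p * 2 + suc s)) (2 + p) / 2)
  × ((M₁ A ≡ bound (3 + (p * 2 + suc s)) (2 + p) / 2) ⇔ InUStar (3 + (p * 2 + suc s)) (2 + p) A)
sharp-bound p s {A} S size noLoop deg≥1 =
    subst (λ z → (M₁ A ≤ℚ z / 2) × ((M₁ A ≡ z / 2) ⇔ InUStar n₀ (2 + p) A)) (sym bound≡)
      (subst (λ q → (q ≤ℚ (+ X -ℤ + 2) / 2) × ((q ≡ (+ X -ℤ + 2) / 2) ⇔ InUStar n₀ (2 + p) A)) (sym (M₁-zagreb A))
        (half-mono (≤-bound bounded) , mk⇔ extremal (λ u → cong (_/ 2) (≡-bound (attained u)))))
  where
  n₀ k X W : ℕ
  n₀ = 3 + (p * 2 + suc s)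
  k = 1 + p + suc s
  X = excess k (2 + p)
  W = clashes (Split.K S) + 2 * ∑ (waste S)
  bound≡ : bound n₀ (2 + p) ≡ + X -ℤ + 2
  bound≡ = trans (cong (λ n → bound n (2 + p)) (arith p (suc s))) (bound-excess k (2 + p))
    where
    arith : ∀ p s → 3 + (p * 2 + s) ≡ 1 + p + s + (2 + p)
    arith = solve-∀
  deficit : zagreb A + W ≡ X
  deficit = trans (zagreb-deficit S deg≥1 size) (cong (λ k → excess k (2 + p)) (k≡ p s S size noLoop))
  attained : InUStar n₀ (2 + p) A → zagreb A + 2 ≡ X
  attained = InUStar⇒zagreb p s A
  -- If `W ≤ 2`, membership in the extremal family already fixes the value, so `W < 2` needs no
  -- separate refutation; otherwise `W` exceeds 2 and the deficit formula gives the inequality.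
  bounded : zagreb A + 2 ≤ X
  bounded with W ≤? 2
  ... | yes W≤2 = ≤-reflexive (attained (small-deficit⇒InUStar p s S size noLoop W≤2))
  ... | no W≰2 = ≤-trans (+-monoʳ-≤ (zagreb A) (<⇒≤ (≰⇒> W≰2))) (≤-reflexive deficit)
  extremal : + zagreb A / 2 ≡ (+ X -ℤ + 2) / 2 → InUStar n₀ (2 + p) A
  extremal eq = small-deficit⇒InUStar p s S size noLoop
    (≤-reflexive (+-cancelˡ-≡ (zagreb A) W 2 (trans deficit (sym (bound-≡ (half-injective (+ zagreb A) (+ X -ℤ + 2) eq))))))

theorem1 : (n m : ℕ) → 2 ≤ m → 2 * m ≤ n →
    (G : Graph n) → ConnectedUnicyclic G → MatchingNumber G m →
    (D : Digraph n) → IsOrientation G D →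
    (M₁ D ≤ℚ ((+ n *ℤ + n) +ℤ ((- (+ 2 *ℤ + m) +ℤ + 3) *ℤ + n) +ℤ (+ m *ℤ + m) +ℤ + m -ℤ + 2) / 2)
    × ((M₁ D ≡ ((+ n *ℤ + n) +ℤ ((- (+ 2 *ℤ + m) +ℤ + 3) *ℤ + n) +ℤ (+ m *ℤ + m) +ℤ + m -ℤ + 2) / 2) ⇔ InUStar n m D)
theorem1 n m 2≤m 2m≤n G (connected , edges) ((M , isMatching) , _) D oriented with shape 2≤m 2m≤n
... | p , s , refl , refl = sharp-bound p s (matching⇒split {G = G} oriented M isMatching)
  (trans (arcs-edges {G = G} oriented) edges) (loopless {G = G} oriented)
  (connected⇒deg≥1 {G = G} oriented connected (s≤s (s≤s z≤n)))
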